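{- Let $0<\alpha,\beta<1$ satisfy $\beta>2-\frac1\alpha$ and $\alpha>2-\frac1\beta$, and let $S\subset\mathbb{R}$ be a Bernstein set. Then Schmidt's game with parameters $\alpha,\beta$ and target set $S$ is not determined, i.e., neither Alice nor Bob has a winning strategy.
   Context: A Bernstein set is a set $S\subset\mathbb{R}$ that has nonempty intersection with every closed uncountable subset of $\mathbb{R}$ but contains no closed uncountable subset of $\mathbb{R}$. Schmidt's game with parameters $0<\alpha,\beta<1$ and target set $S\subset\mathbb{R}$: Bob first chooses a compact interval $B_0$ of positive length. Alice then chooses a compact interval $A_0\subset B_0$ with $|A_0|=\alpha|B_0|$. Bob then chooses a compact interval $B_1\subset A_0$ with $|B_1|=\beta|A_0|$, and so on: $A_n\subset B_n$ with $|A_n|=\alpha|B_n|$ and $B_{n+1}\subset A_n$ with $|B_{n+1}|=\beta|A_n|$. Here $|I|$ is the length of the interval $I$. Alice wins if $\bigcap_{n\ge0}B_n$ has nonempty intersection with $S$; otherwise Bob wins. A strategy is a rule specifying a legal move for a player in every situation as a function of previously chosen intervals; it is winning if it guarantees that player wins regardless of the opponent's moves. The game is determined on $S$ if one of the players has a winning strategy, and not determined otherwise. -}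

module Defs where

open import Data.Nat.Base as ℕ using (ℕ; zero; suc)
import Data.Nat.Properties as ℕ
open import Data.Integer.Base using (+_)
open import Data.Rational.Base as ℚ using (ℚ; 0ℚ; 1ℚ; ½)
import Data.Rational.Properties as ℚ
open import Data.Rational.Solver using (module +-*-Solver)
open import Data.List.Base using (List; []; _∷_)
open import Data.List.Relation.Binary.Pointwise.Base using (Pointwise)
open import Data.Product.Base using (Σ; ∃; ∃-syntax; _×_; _,_; proj₁; proj₂)
open import Data.Sum.Base using (_⊎_)
open import Function.Base using (flip)
open import Level using (0ℓ)
open import Relation.Binary.Core using (Rel)
open import Relation.Binary.Definitions using (_Respects_)
open import Relation.Binary.PropositionalEquality
  using (_≡_; refl; sym; cong; cong₂; subst; module ≡-Reasoning)
open import Relation.Nullary using (¬_; yes; no; contradiction)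
open import Relation.Unary using (Pred; _∈_; _⊆_; _≬_; ⋂)

-- Real numbers: Cauchy sequences of rationals, equal when their
-- difference tends to 0. Operations are termwise.

IsCauchy : Pred (ℕ → ℚ) 0ℓ
IsCauchy s = ∀ ε → 0ℚ ℚ.< ε →
  ∃[ N ] (∀ m n → N ℕ.≤ m → N ℕ.≤ n → ℚ.∣ s m ℚ.- s n ∣ ℚ.< ε)

record ℝ : Set where
  constructor mkℝ
  field
    seq    : ℕ → ℚ
    cauchy : IsCauchy seq

open ℝ public

infix 4 _≈_ _<_ _>_ _≤_

_≈_ : Rel ℝ 0ℓ
x ≈ y = ∀ ε → 0ℚ ℚ.< ε →
  ∃[ N ] (∀ n → N ℕ.≤ n → ℚ.∣ seq x n ℚ.- seq y n ∣ ℚ.< ε)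

_<_ : Rel ℝ 0ℓ
x < y = ∃[ ε ] (0ℚ ℚ.< ε ×
  ∃[ N ] (∀ n → N ℕ.≤ n → seq x n ℚ.+ ε ℚ.≤ seq y n))

_>_ : Rel ℝ 0ℓ
_>_ = flip _<_

_≤_ : Rel ℝ 0ℓ
x ≤ y = ¬ (y < x)

private

  open +-*-Solver using (solve; _:+_; _:*_; :-_; con; _:=_)

  +-diff : ∀ a b c d → a ℚ.+ b ℚ.- (c ℚ.+ d) ≡ (a ℚ.- c) ℚ.+ (b ℚ.- d)
  +-diff = solve 4 (λ a b c d →
    a :+ b :+ :- (c :+ d) := (a :+ :- c) :+ (b :+ :- d)) refl

  +-shift : ∀ a b → a ≡ b ℚ.+ (a ℚ.- b)
  +-shift = solve 2 (λ a b → a := b :+ (a :+ :- b)) refl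

  *-diff : ∀ a b c d → a ℚ.* b ℚ.- c ℚ.* d ≡ a ℚ.* (b ℚ.- d) ℚ.+ (a ℚ.- c) ℚ.* d
  *-diff = solve 4 (λ a b c d →
    a :* b :+ :- (c :* d) := a :* (b :+ :- d) :+ (a :+ :- c) :* d) refl

  share : ∀ k l e i → k ℚ.* (e ℚ.* i) ℚ.+ (e ℚ.* i) ℚ.* l ≡ e ℚ.* ((k ℚ.+ l) ℚ.* i)
  share = solve 4 (λ k l e i →
    k :* (e :* i) :+ (e :* i) :* l := e :* ((k :+ l) :* i)) refl

  cross : ∀ r s a b →
    (r ℚ.- s) ℚ.* (a ℚ.* b) ≡ (r ℚ.* a) ℚ.* b ℚ.- (s ℚ.* b) ℚ.* a
  cross = solve 4 (λ r s a b →
    (r :+ :- s) :* (a :* b) := (r :* a) :* b :+ :- ((s :* b) :* a)) refl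

  flip-diff : ∀ a b → 1ℚ ℚ.* b ℚ.- 1ℚ ℚ.* a ≡ ℚ.- (a ℚ.- b)
  flip-diff = solve 2 (λ a b →
    con 1ℚ :* b :+ :- (con 1ℚ :* a) := :- (a :+ :- b)) refl

  half-pos : ∀ {ε} → 0ℚ ℚ.< ε → 0ℚ ℚ.< ½ ℚ.* ε
  half-pos {ε} ε>0 =
    subst (ℚ._< ½ ℚ.* ε) (ℚ.*-zeroʳ ½) (ℚ.*-monoʳ-<-pos ½ ε>0)

  halves : ∀ ε → ½ ℚ.* ε ℚ.+ ½ ℚ.* ε ≡ ε
  halves ε = begin
    ½ ℚ.* ε ℚ.+ ½ ℚ.* ε  ≡⟨ ℚ.*-distribʳ-+ ε ½ ½ ⟨
    1ℚ ℚ.* ε             ≡⟨ ℚ.*-identityˡ ε ⟩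
    ε                    ∎
    where open ≡-Reasoning

  *-pos : ∀ {p q} → 0ℚ ℚ.< p → 0ℚ ℚ.< q → 0ℚ ℚ.< p ℚ.* q
  *-pos {p} {q} p>0 q>0 = ℚ.positive⁻¹ (p ℚ.* q)
    {{ℚ.pos*pos⇒pos p {{ℚ.positive p>0}} q {{ℚ.positive q>0}}}}

fromℚ : ℚ → ℝ
fromℚ q = mkℝ (λ _ → q) λ ε ε>0 → 0 , λ _ _ _ _ →
  subst (ℚ._< ε) (sym (cong ℚ.∣_∣ (ℚ.+-inverseʳ q))) ε>0

0ℝ 1ℝ 2ℝ : ℝ
0ℝ = fromℚ 0ℚ
1ℝ = fromℚ 1ℚ
2ℝ = fromℚ (+ 2 ℚ./ 1)

infixl 6 _+_ _-_
infixl 7 _*_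
infix  8 -_

_+_ : ℝ → ℝ → ℝ
x + y = mkℝ (λ n → seq x n ℚ.+ seq y n) +-cauchy
  where
  +-cauchy : IsCauchy (λ n → seq x n ℚ.+ seq y n)
  +-cauchy ε ε>0 with cauchy x (½ ℚ.* ε) (half-pos ε>0) | cauchy y (½ ℚ.* ε) (half-pos ε>0)
  ... | M , x-close | N , y-close = M ℕ.⊔ N , λ m n m≥ n≥ →
    let a = seq x m ; b = seq y m ; c = seq x n ; d = seq y n in
    begin-strict
      ℚ.∣ a ℚ.+ b ℚ.- (c ℚ.+ d) ∣
        ≡⟨ cong ℚ.∣_∣ (+-diff a b c d) ⟩
      ℚ.∣ (a ℚ.- c) ℚ.+ (b ℚ.- d) ∣
        ≤⟨ ℚ.∣p+q∣≤∣p∣+∣q∣ (a ℚ.- c) (b ℚ.- d) ⟩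
      ℚ.∣ a ℚ.- c ∣ ℚ.+ ℚ.∣ b ℚ.- d ∣
        <⟨ ℚ.+-mono-<
             (x-close m n (ℕ.m⊔n≤o⇒m≤o M N m≥) (ℕ.m⊔n≤o⇒m≤o M N n≥))
             (y-close m n (ℕ.m⊔n≤o⇒n≤o M N m≥) (ℕ.m⊔n≤o⇒n≤o M N n≥)) ⟩
      ½ ℚ.* ε ℚ.+ ½ ℚ.* ε
        ≡⟨ halves ε ⟩
      ε ∎
    where open ℚ.≤-Reasoning

-_ : ℝ → ℝ
- x = mkℝ (λ n → ℚ.- seq x n) neg-cauchy
  where
  open ≡-Reasoning
  neg-dist : ∀ p q → ℚ.∣ ℚ.- p ℚ.- ℚ.- q ∣ ≡ ℚ.∣ p ℚ.- q ∣
  neg-dist p q = begin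
    ℚ.∣ ℚ.- p ℚ.- ℚ.- q ∣  ≡⟨ cong ℚ.∣_∣ (ℚ.neg-distrib-+ p (ℚ.- q)) ⟨
    ℚ.∣ ℚ.- (p ℚ.- q) ∣    ≡⟨ ℚ.∣-p∣≡∣p∣ (p ℚ.- q) ⟩
    ℚ.∣ p ℚ.- q ∣          ∎
  neg-cauchy : IsCauchy (λ n → ℚ.- seq x n)
  neg-cauchy ε ε>0 with cauchy x ε ε>0
  ... | N , close = N , λ m n m≥ n≥ →
    subst (ℚ._< ε) (sym (neg-dist (seq x m) (seq x n))) (close m n m≥ n≥)

_-_ : ℝ → ℝ → ℝ
x - y = x + (- y)

private

  bounded : ∀ x → ∃[ K ] (0ℚ ℚ.< K × ∃[ N ] (∀ n → N ℕ.≤ n → ℚ.∣ seq x n ∣ ℚ.≤ K))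
  bounded x with cauchy x 1ℚ (ℚ.positive⁻¹ 1ℚ)
  ... | N , close = ℚ.∣ seq x N ∣ ℚ.+ 1ℚ , K>0 , N , λ n n≥ →
    let a = seq x n ; b = seq x N in
    begin
      ℚ.∣ a ∣
        ≡⟨ cong ℚ.∣_∣ (+-shift a b) ⟩
      ℚ.∣ b ℚ.+ (a ℚ.- b) ∣
        ≤⟨ ℚ.∣p+q∣≤∣p∣+∣q∣ b (a ℚ.- b) ⟩
      ℚ.∣ b ∣ ℚ.+ ℚ.∣ a ℚ.- b ∣
        ≤⟨ ℚ.+-monoʳ-≤ ℚ.∣ b ∣ (ℚ.<⇒≤ (close n N n≥ ℕ.≤-refl)) ⟩
      ℚ.∣ b ∣ ℚ.+ 1ℚ ∎
    where
    open ℚ.≤-Reasoning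
    K>0 : 0ℚ ℚ.< ℚ.∣ seq x N ∣ ℚ.+ 1ℚ
    K>0 = ℚ.+-mono-≤-< (ℚ.0≤∣p∣ (seq x N)) (ℚ.positive⁻¹ 1ℚ)

  *-close : ∀ a b c d {K L δ} → 0ℚ ℚ.< K → 0ℚ ℚ.< L →
    ℚ.∣ a ∣ ℚ.≤ K → ℚ.∣ d ∣ ℚ.≤ L → ℚ.∣ a ℚ.- c ∣ ℚ.< δ → ℚ.∣ b ℚ.- d ∣ ℚ.< δ →
    ℚ.∣ a ℚ.* b ℚ.- c ℚ.* d ∣ ℚ.< K ℚ.* δ ℚ.+ δ ℚ.* L
  *-close a b c d {K} {L} {δ} K>0 L>0 a≤K d≤L ac<δ bd<δ = begin-strict
    ℚ.∣ a ℚ.* b ℚ.- c ℚ.* d ∣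
      ≡⟨ cong ℚ.∣_∣ (*-diff a b c d) ⟩
    ℚ.∣ a ℚ.* (b ℚ.- d) ℚ.+ (a ℚ.- c) ℚ.* d ∣
      ≤⟨ ℚ.∣p+q∣≤∣p∣+∣q∣ (a ℚ.* (b ℚ.- d)) ((a ℚ.- c) ℚ.* d) ⟩
    ℚ.∣ a ℚ.* (b ℚ.- d) ∣ ℚ.+ ℚ.∣ (a ℚ.- c) ℚ.* d ∣
      ≡⟨ cong₂ ℚ._+_ (ℚ.∣p*q∣≡∣p∣*∣q∣ a (b ℚ.- d)) (ℚ.∣p*q∣≡∣p∣*∣q∣ (a ℚ.- c) d) ⟩
    ℚ.∣ a ∣ ℚ.* ℚ.∣ b ℚ.- d ∣ ℚ.+ ℚ.∣ a ℚ.- c ∣ ℚ.* ℚ.∣ d ∣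
      ≤⟨ ℚ.+-mono-≤
           (ℚ.*-monoʳ-≤-nonNeg ℚ.∣ b ℚ.- d ∣ {{ℚ.∣-∣-nonNeg (b ℚ.- d)}} a≤K)
           (ℚ.*-monoˡ-≤-nonNeg ℚ.∣ a ℚ.- c ∣ {{ℚ.∣-∣-nonNeg (a ℚ.- c)}} d≤L) ⟩
    K ℚ.* ℚ.∣ b ℚ.- d ∣ ℚ.+ ℚ.∣ a ℚ.- c ∣ ℚ.* L
      <⟨ ℚ.+-mono-<
           (ℚ.*-monoʳ-<-pos K {{ℚ.positive K>0}} bd<δ)
           (ℚ.*-monoˡ-<-pos L {{ℚ.positive L>0}} ac<δ) ⟩
    K ℚ.* δ ℚ.+ δ ℚ.* L ∎
    where open ℚ.≤-Reasoning

  split : ∀ {K L ε} → 0ℚ ℚ.< K → 0ℚ ℚ.< L → 0ℚ ℚ.< ε →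
    ∃[ δ ] (0ℚ ℚ.< δ × K ℚ.* δ ℚ.+ δ ℚ.* L ≡ ε)
  split {K} {L} {ε} K>0 L>0 ε>0 = ε ℚ.* i , *-pos ε>0 i>0 , (begin
    K ℚ.* (ε ℚ.* i) ℚ.+ (ε ℚ.* i) ℚ.* L  ≡⟨ share K L ε i ⟩
    ε ℚ.* ((K ℚ.+ L) ℚ.* i)
      ≡⟨ cong (ε ℚ.*_) (ℚ.*-inverseʳ (K ℚ.+ L) {{ℚ.pos⇒nonZero (K ℚ.+ L) {{pos}}}}) ⟩
    ε ℚ.* 1ℚ                              ≡⟨ ℚ.*-identityʳ ε ⟩
    ε                                     ∎)
    where
    open ≡-Reasoning
    pos = ℚ.positive (ℚ.+-mono-< K>0 L>0)
    i = (ℚ.1/ (K ℚ.+ L)) {{ℚ.pos⇒nonZero (K ℚ.+ L) {{pos}}}}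
    i>0 = ℚ.positive⁻¹ i {{ℚ.1/pos⇒pos (K ℚ.+ L) {{pos}}}}

_*_ : ℝ → ℝ → ℝ
x * y = mkℝ (λ n → seq x n ℚ.* seq y n) *-cauchy
  where
  *-cauchy : IsCauchy (λ n → seq x n ℚ.* seq y n)
  *-cauchy ε ε>0 =
    let (K , K>0 , M , x≤K) = bounded x
        (L , L>0 , N , y≤L) = bounded y
        (δ , δ>0 , δ-split) = split K>0 L>0 ε>0
        (M′ , x-close)      = cauchy x δ δ>0
        (N′ , y-close)      = cauchy y δ δ>0
    in
    (M ℕ.⊔ N) ℕ.⊔ (M′ ℕ.⊔ N′) , λ m n m≥ n≥ →
    let m≥′ = ℕ.m⊔n≤o⇒n≤o (M ℕ.⊔ N) (M′ ℕ.⊔ N′) m≥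
        n≥′ = ℕ.m⊔n≤o⇒n≤o (M ℕ.⊔ N) (M′ ℕ.⊔ N′) n≥
    in
    subst (ℚ.∣ seq x m ℚ.* seq y m ℚ.- seq x n ℚ.* seq y n ∣ ℚ.<_) δ-split
      (*-close (seq x m) (seq y m) (seq x n) (seq y n) K>0 L>0
        (x≤K m (ℕ.m⊔n≤o⇒m≤o M N (ℕ.m⊔n≤o⇒m≤o (M ℕ.⊔ N) (M′ ℕ.⊔ N′) m≥)))
        (y≤L n (ℕ.m⊔n≤o⇒n≤o M N (ℕ.m⊔n≤o⇒m≤o (M ℕ.⊔ N) (M′ ℕ.⊔ N′) n≥)))
        (x-close m n (ℕ.m⊔n≤o⇒m≤o M′ N′ m≥′) (ℕ.m⊔n≤o⇒m≤o M′ N′ n≥′))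
        (y-close m n (ℕ.m⊔n≤o⇒n≤o M′ N′ m≥′) (ℕ.m⊔n≤o⇒n≤o M′ N′ n≥′)))

-- Total on ℚ so that it can be applied termwise: finitely many terms of a
-- Cauchy sequence representing a positive real may be 0.
recip : ℚ → ℚ
recip q with q ℚ.≟ 0ℚ
... | yes _   = 0ℚ
... | no  q≢0 = (ℚ.1/ q) {{ℚ.≢-nonZero q≢0}}

private

  recip-inverse : ∀ q → 0ℚ ℚ.< q → recip q ℚ.* q ≡ 1ℚ
  recip-inverse q q>0 with q ℚ.≟ 0ℚ
  ... | yes q≡0 = contradiction (sym q≡0) (ℚ.<⇒≢ q>0)
  ... | no  q≢0 = ℚ.*-inverseˡ q {{ℚ.≢-nonZero q≢0}}

inverse : (x : ℝ) → 0ℝ < x → ℝ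
inverse x (c , c>0 , M , x≥c) = mkℝ (λ n → recip (seq x n)) inv-cauchy
  where
  open ℚ.≤-Reasoning
  c≤ : ∀ n → M ℕ.≤ n → c ℚ.≤ seq x n
  c≤ n n≥ = subst (ℚ._≤ seq x n) (ℚ.+-identityˡ c) (x≥c n n≥)

  recip-close : ∀ ε → 0ℚ ℚ.< ε → ∀ a b → c ℚ.≤ a → c ℚ.≤ b →
    ℚ.∣ a ℚ.- b ∣ ℚ.< ε ℚ.* (c ℚ.* c) → ℚ.∣ recip a ℚ.- recip b ∣ ℚ.< ε
  recip-close ε ε>0 a b c≤a c≤b close =
    ℚ.*-cancelʳ-<-nonNeg (a ℚ.* b) (begin-strict
      ℚ.∣ r ℚ.- s ∣ ℚ.* (a ℚ.* b)
        ≡⟨ cong (ℚ.∣ r ℚ.- s ∣ ℚ.*_) (ℚ.0≤p⇒∣p∣≡p (ℚ.<⇒≤ (*-pos a>0 b>0))) ⟨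
      ℚ.∣ r ℚ.- s ∣ ℚ.* ℚ.∣ a ℚ.* b ∣
        ≡⟨ ℚ.∣p*q∣≡∣p∣*∣q∣ (r ℚ.- s) (a ℚ.* b) ⟨
      ℚ.∣ (r ℚ.- s) ℚ.* (a ℚ.* b) ∣
        ≡⟨ cong ℚ.∣_∣ (cross r s a b) ⟩
      ℚ.∣ (r ℚ.* a) ℚ.* b ℚ.- (s ℚ.* b) ℚ.* a ∣
        ≡⟨ cong₂ (λ u v → ℚ.∣ u ℚ.* b ℚ.- v ℚ.* a ∣) (recip-inverse a a>0) (recip-inverse b b>0) ⟩
      ℚ.∣ 1ℚ ℚ.* b ℚ.- 1ℚ ℚ.* a ∣
        ≡⟨ cong ℚ.∣_∣ (flip-diff a b) ⟩
      ℚ.∣ ℚ.- (a ℚ.- b) ∣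
        ≡⟨ ℚ.∣-p∣≡∣p∣ (a ℚ.- b) ⟩
      ℚ.∣ a ℚ.- b ∣
        <⟨ close ⟩
      ε ℚ.* (c ℚ.* c)
        ≤⟨ ℚ.*-monoˡ-≤-nonNeg ε (ℚ.≤-trans (ℚ.*-monoˡ-≤-nonNeg c c≤b) (ℚ.*-monoʳ-≤-nonNeg b c≤a)) ⟩
      ε ℚ.* (a ℚ.* b) ∎)
    where
    r = recip a
    s = recip b
    a>0 = ℚ.<-≤-trans c>0 c≤a
    b>0 = ℚ.<-≤-trans c>0 c≤b
    instance
      _ = ℚ.nonNegative (ℚ.<⇒≤ c>0)
      _ = ℚ.nonNegative (ℚ.<⇒≤ ε>0)
      _ = ℚ.nonNegative (ℚ.<⇒≤ b>0)
      _ = ℚ.nonNegative (ℚ.<⇒≤ (*-pos a>0 b>0))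

  inv-cauchy : IsCauchy (λ n → recip (seq x n))
  inv-cauchy ε ε>0 with cauchy x (ε ℚ.* (c ℚ.* c)) (*-pos ε>0 (*-pos c>0 c>0))
  ... | N , close = M ℕ.⊔ N , λ m n m≥ n≥ →
    recip-close ε ε>0 (seq x m) (seq x n)
      (c≤ m (ℕ.m⊔n≤o⇒m≤o M N m≥)) (c≤ n (ℕ.m⊔n≤o⇒m≤o M N n≥))
      (close m n (ℕ.m⊔n≤o⇒n≤o M N m≥) (ℕ.m⊔n≤o⇒n≤o M N n≥))

IsClosed : Pred (Pred ℝ 0ℓ) 0ℓ
IsClosed F = ∀ x →
  (∀ ε → 0ℝ < ε → ∃[ y ] (y ∈ F × x - ε < y × y < x + ε)) → x ∈ F

-- The listing may have repetitions and terms outside F, so that finite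
-- sets (including ∅) are countable.
IsCountable : Pred (Pred ℝ 0ℓ) 0ℓ
IsCountable F = Σ (ℕ → ℝ) λ f → ∀ x → x ∈ F → ∃[ n ] x ≈ f n

record IsClosedUncountable (F : Pred ℝ 0ℓ) : Set where
  field
    respects    : F Respects _≈_
    closed      : IsClosed F
    uncountable : ¬ IsCountable F

record IsBernstein (S : Pred ℝ 0ℓ) : Set₁ where
  field
    respects : S Respects _≈_
    meets    : ∀ F → IsClosedUncountable F → S ≬ F
    omits    : ∀ F → IsClosedUncountable F → ¬ (F ⊆ S)

record Interval : Set where
  field
    lo hi : ℝ
    lo≤hi : lo ≤ hi

open Interval public

⟦_⟧ : Interval → Pred ℝ 0ℓ
⟦ I ⟧ x = lo I ≤ x × x ≤ hi I

∣_∣ : Interval → ℝ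
∣ I ∣ = hi I - lo I

infix 4 _≈ᴵ_
_≈ᴵ_ : Rel Interval 0ℓ
I ≈ᴵ J = lo I ≈ lo J × hi I ≈ hi J

data Player : Set where
  alice bob : Player

opponent : Player → Player
opponent alice = bob
opponent bob   = alice

module Schmidt (α β : ℝ) where

  -- Situation P h: the list h of intervals chosen so far, most recent
  -- first, was produced by legal moves, and P is to move. A move I is
  -- thus legal for P after h when Situation (opponent P) (I ∷ h).
  data Situation : Player → List Interval → Set where
    start     : Situation bob []
    opening   : ∀ {B} → 0ℝ < ∣ B ∣ → Situation alice (B ∷ [])
    aliceMove : ∀ {h A B} → Situation alice (B ∷ h) →
                ⟦ A ⟧ ⊆ ⟦ B ⟧ → ∣ A ∣ ≈ α * ∣ B ∣ → Situation bob (A ∷ B ∷ h)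
    bobMove   : ∀ {h A B} → Situation bob (A ∷ h) →
                ⟦ B ⟧ ⊆ ⟦ A ⟧ → ∣ B ∣ ≈ β * ∣ A ∣ → Situation alice (B ∷ A ∷ h)

  record Strategy (P : Player) : Set where
    field
      move      : ∀ {h} → Situation P h → Interval
      legal     : ∀ {h} (s : Situation P h) → Situation (opponent P) (move s ∷ h)
      move-cong : ∀ {h h′} (s : Situation P h) (s′ : Situation P h′) →
                  Pointwise _≈ᴵ_ h h′ → move s ≈ᴵ move s′

  open Strategy public

  -- The first n rounds (B₀, A₀, …, Bₙ₋₁, Aₙ₋₁), most recent first.
  rounds : (B A : ℕ → Interval) → ℕ → List Interval
  rounds B A zero    = []
  rounds B A (suc n) = A n ∷ B n ∷ rounds B A n

  record Play : Set where
    field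
      B A         : ℕ → Interval
      bobToMove   : ∀ n → Situation bob   (rounds B A n)
      aliceToMove : ∀ n → Situation alice (B n ∷ rounds B A n)

  open Play public

  Follows : (P : Player) → Strategy P → Pred Play 0ℓ
  Follows alice σ p = ∀ n → A p n ≈ᴵ move σ (aliceToMove p n)
  Follows bob   σ p = ∀ n → B p n ≈ᴵ move σ (bobToMove p n)

  Wins : Player → Pred ℝ 0ℓ → Pred Play 0ℓ
  Wins alice S p = ⋂ ℕ (λ n → ⟦ B p n ⟧) ≬ S
  Wins bob   S p = ¬ Wins alice S p

  HasWinningStrategy : Player → Pred (Pred ℝ 0ℓ) 0ℓ
  HasWinningStrategy P S = Σ (Strategy P) λ σ → ∀ p → Follows P σ p → Wins P S p

  Determined : Pred (Pred ℝ 0ℓ) 0ℓ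
  Determined S = HasWinningStrategy alice S ⊎ HasWinningStrategy bob S

{-# OPTIONS --safe #-}

-- Against a strategy σ the opponent cuts, in each round, either the left or the right end
-- off the current interval I. With γ the opponent's ratio and δ that of σ, the reply is
-- an interval of length γδ∣I∣ inside the end piece, so its centre lies at least
-- (1 - 2γ + γδ)∣I∣/2 to the left or to the right of that of I, and the assumption on α and β
-- says that 1 - 2γ + γδ > 0. The ends may overlap (γ > 1/2), but if the opponent stays on
-- the same side for N rounds, the centres keep moving that way while the intervals become
-- short, so for large N the two resulting intervals are disjoint. Choosing a side for each
-- block of N rounds thus gives a Cantor set of outcomes, which is closed and uncountable:
-- it meets S, so σ does not win for Bob, and is not contained in S, so σ does not win
-- for Alice.
module Submission where

open import Defs
open import Data.Bool.Base using (Bool; true; false)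
open import Data.Empty using (⊥; ⊥-elim)
open import Data.Integer.Base as ℤ using (+_; -[1+_])
import Data.Integer.Properties as ℤ
open import Data.List.Base using (List; []; _∷_)
open import Data.List.Relation.Binary.Pointwise.Base using (Pointwise; []; _∷_)
open import Data.Nat.Base as ℕ using (ℕ; zero; suc)
open import Data.Nat.DivMod using (_/_; +-distrib-/-∣ʳ; m*n/n≡m; m<n⇒m/n≡0)
open import Data.Nat.Divisibility using (n∣m*n)
import Data.Nat.Properties as ℕ
open import Data.Product.Base using (Σ; ∃-syntax; _×_; _,_; proj₁; proj₂)
open import Data.Rational.Base as ℚ using (ℚ; mkℚ; 0ℚ; 1ℚ; ½; toℚᵘ)
import Data.Rational.Properties as ℚ
open import Data.Rational.Solver using (module +-*-Solver)
open import Data.Rational.Unnormalised.Base as ℚᵘ using (mkℚᵘ; *≡*; *≤*)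
import Data.Rational.Unnormalised.Properties as ℚᵘ
open import Data.Sum.Base using (_⊎_; inj₁; inj₂; [_,_]′; fromInj₁)
open import Function.Base using (_∘_; const)
open import Level using (0ℓ)
open import Relation.Binary.PropositionalEquality
  using (_≡_; refl; sym; trans; cong; cong₂; subst; subst₂; module ≡-Reasoning)
open import Relation.Nullary using (¬_; yes; no; contradiction)
open import Relation.Unary using (Pred; _∈_; _⊆_)

open +-*-Solver using (solve; _:+_; _:-_; _:*_; :-_; con; _:=_)

-- Rational arithmetic and the Archimedean property

ℚ-gap : ∀ {p q} → p ℚ.≤ q → 0ℚ ℚ.≤ q ℚ.- p
ℚ-gap {p} {q} p≤q = subst (ℚ._≤ q ℚ.- p) (ℚ.+-inverseʳ p) (ℚ.+-monoˡ-≤ (ℚ.- p) p≤q)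

ℚ-gap⁻¹ : ∀ {p q r} → 0ℚ ℚ.≤ r → r ≡ q ℚ.- p → p ℚ.≤ q
ℚ-gap⁻¹ {p} {q} {r} r≥0 eq = subst₂ ℚ._≤_ (ℚ.+-identityˡ p)
  (trans (cong (ℚ._+ p) eq) (solve 2 (λ p q → q :- p :+ p := q) refl p q))
  (ℚ.+-monoˡ-≤ p r≥0)

ℚ-+-nonNeg : ∀ {p q} → 0ℚ ℚ.≤ p → 0ℚ ℚ.≤ q → 0ℚ ℚ.≤ p ℚ.+ q
ℚ-+-nonNeg p≥0 q≥0 = ℚ.+-mono-≤ p≥0 q≥0

ℚ-*-nonNeg : ∀ {p q} → 0ℚ ℚ.≤ p → 0ℚ ℚ.≤ q → 0ℚ ℚ.≤ p ℚ.* q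
ℚ-*-nonNeg {p} {q} p≥0 q≥0 = subst (ℚ._≤ p ℚ.* q) (ℚ.*-zeroʳ p)
  (ℚ.*-monoˡ-≤-nonNeg p {{ℚ.nonNegative p≥0}} q≥0)

ℚ-*-pos : ∀ {p q} → 0ℚ ℚ.< p → 0ℚ ℚ.< q → 0ℚ ℚ.< p ℚ.* q
ℚ-*-pos {p} {q} p>0 q>0 = subst (ℚ._< p ℚ.* q) (ℚ.*-zeroʳ p)
  (ℚ.*-monoʳ-<-pos p {{ℚ.positive p>0}} q>0)

half-pos : ∀ {p} → 0ℚ ℚ.< p → 0ℚ ℚ.< ½ ℚ.* p
half-pos = ℚ-*-pos (ℚ.positive⁻¹ ½)

positive-⊓ : ∀ {p q} → 0ℚ ℚ.< p → 0ℚ ℚ.< q → ∃[ r ] (0ℚ ℚ.< r × r ℚ.≤ p × r ℚ.≤ q)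
positive-⊓ {p} {q} p>0 q>0 with ℚ.≤-total p q
... | inj₁ p≤q = p , p>0 , ℚ.≤-refl , p≤q
... | inj₂ q≤p = q , q>0 , q≤p , ℚ.≤-refl

p≤∣p∣ : ∀ p → p ℚ.≤ ℚ.∣ p ∣
p≤∣p∣ p with ℚ.≤-total 0ℚ p
... | inj₁ 0≤p = ℚ.≤-reflexive (sym (ℚ.0≤p⇒∣p∣≡p 0≤p))
... | inj₂ p≤0 = ℚ.≤-trans p≤0 (ℚ.0≤∣p∣ p)

∣p-q∣<r⇒p-q≤r : ∀ {p q r} → ℚ.∣ p ℚ.- q ∣ ℚ.< r → p ℚ.- q ℚ.≤ r
∣p-q∣<r⇒p-q≤r {p} {q} = ℚ.≤-trans (p≤∣p∣ (p ℚ.- q)) ∘ ℚ.<⇒≤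

half<self : ∀ {p} → 0ℚ ℚ.< p → ½ ℚ.* p ℚ.< p
half<self {p} p>0 = subst₂ ℚ._<_ (ℚ.+-identityʳ (½ ℚ.* p))
  (solve 1 (λ p → con ½ :* p :+ con ½ :* p := p) refl p)
  (ℚ.+-monoʳ-< (½ ℚ.* p) (half-pos p>0))

∣p-q∣<r : ∀ {p q r} → p ℚ.- q ℚ.< r → q ℚ.- p ℚ.< r → ℚ.∣ p ℚ.- q ∣ ℚ.< r
∣p-q∣<r {p} {q} {r} p-q<r q-p<r with ℚ.∣p∣≡p∨∣p∣≡-p (p ℚ.- q)
... | inj₁ eq = subst (ℚ._< r) (sym eq) p-q<r
... | inj₂ eq = subst (ℚ._< r)
  (trans (solve 2 (λ p q → q :- p := :- (p :- q)) refl p q) (sym eq)) q-p<r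

ℚ-inverse : ∀ {q} → 0ℚ ℚ.< q → ∃[ r ] (0ℚ ℚ.< r × r ℚ.* q ≡ 1ℚ)
ℚ-inverse {q} q>0 =
  ℚ.1/ q , ℚ.positive⁻¹ (ℚ.1/ q) {{ℚ.1/pos⇒pos q}} , ℚ.*-inverseˡ q
  where
  instance
    _ = ℚ.positive q>0
    _ = ℚ.pos⇒nonZero q

-- Repeated addition instead of a product with a natural number: each successor unfolds to a sum
-- that the ring solver can treat.
multiple : ℕ → ℚ → ℚ
multiple zero    q = 0ℚ
multiple (suc n) q = q ℚ.+ multiple n q

archimedean : ∀ p {q} → 0ℚ ℚ.< q → ∃[ n ] p ℚ.≤ multiple n q
archimedean p {q} q>0 = n , subst₂ ℚ._≤_
  (trans (ℚ.*-assoc p (ℚ.1/ q) q)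
    (trans (cong (p ℚ.*_) (ℚ.*-inverseˡ q)) (ℚ.*-identityʳ p)))
  (multiple-* n)
  (ℚ.*-monoʳ-≤-nonNeg q {{ℚ.pos⇒nonNeg q}} (below (p ℚ.* (ℚ.1/ q))))
  where
  instance
    _ = ℚ.positive q>0
    _ = ℚ.pos⇒nonZero q
  -- A rational is at most the absolute value of its numerator, as its denominator is at least 1;
  -- this is applied to p / q.
  n = ℤ.∣ ℚ.numerator (p ℚ.* (ℚ.1/ q)) ∣
  multiple-* : ∀ n → multiple n 1ℚ ℚ.* q ≡ multiple n q
  multiple-* zero    = ℚ.*-zeroˡ q
  multiple-* (suc n) = trans (ℚ.*-distribʳ-+ q 1ℚ (multiple n 1ℚ))
    (cong₂ ℚ._+_ (ℚ.*-identityˡ q) (multiple-* n))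
  multiple-1 : ∀ n → toℚᵘ (multiple n 1ℚ) ℚᵘ.≃ mkℚᵘ (+ n) 0
  multiple-1 zero    = *≡* refl
  multiple-1 (suc n) = ℚᵘ.≃-trans (ℚ.toℚᵘ-homo-+ 1ℚ (multiple n 1ℚ))
    (ℚᵘ.≃-trans (ℚᵘ.+-cong (*≡* {toℚᵘ 1ℚ} {mkℚᵘ (+ 1) 0} refl) (multiple-1 n))
      (*≡* (cong ((ℤ._* + 1) ∘ (ℤ._+_ (+ 1))) (ℤ.*-identityʳ (+ n)))))
  below : ∀ p → p ℚ.≤ multiple ℤ.∣ ℚ.numerator p ∣ 1ℚ
  below p@(mkℚ m d _) = ℚ.toℚᵘ-cancel-≤ (ℚᵘ.≤-trans (*≤* (num m))
    (ℚᵘ.≤-reflexive (ℚᵘ.≃-sym (multiple-1 ℤ.∣ m ∣))))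
    where
    num : ∀ m → m ℤ.* + 1 ℤ.≤ + ℤ.∣ m ∣ ℤ.* + suc d
    num (+ k)      = subst₂ ℤ._≤_ (sym (ℤ.*-identityʳ (+ k))) (ℤ.pos-* k (suc d))
      (ℤ.+≤+ (ℕ.m≤m*n k (suc d)))
    num (-[1+ k ]) = ℤ.-≤+

-- Nonnegative reals and the order

-- Inequalities between reals are derived as nonnegative combinations of the hypotheses,
-- up to a ring identity that holds termwise in ℚ.
record NonNeg (z : ℝ) : Set where
  constructor nonNeg
  field
    approx : ∀ ε → 0ℚ ℚ.< ε → ∃[ N ] (∀ n → N ℕ.≤ n → 0ℚ ℚ.≤ seq z n ℚ.+ ε)

open NonNeg

-- Also needed between convertible reals: comparing their moduli of Cauchyness is too slow.
nonNeg-ext : ∀ {z z′} → NonNeg z → (∀ n → seq z n ≡ seq z′ n) → NonNeg z′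
nonNeg-ext z≥0 eq = nonNeg λ ε ε>0 → let (N , z≥) = approx z≥0 ε ε>0 in
  N , λ n N≤n → subst (λ q → 0ℚ ℚ.≤ q ℚ.+ ε) (eq n) (z≥ n N≤n)

infixl 6 _⊕_

_⊕_ : ∀ {x y} → NonNeg x → NonNeg y → NonNeg (x + y)
_⊕_ {x} {y} x≥0 y≥0 = nonNeg λ ε ε>0 →
  let (M , x≥) = approx x≥0 (½ ℚ.* ε) (half-pos ε>0)
      (N , y≥) = approx y≥0 (½ ℚ.* ε) (half-pos ε>0)
  in M ℕ.⊔ N , λ n n≥ → subst (0ℚ ℚ.≤_)
    (solve 3 (λ x y ε → x :+ con ½ :* ε :+ (y :+ con ½ :* ε) := x :+ y :+ ε) refl
      (seq x n) (seq y n) ε)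
    (ℚ-+-nonNeg (x≥ n (ℕ.m⊔n≤o⇒m≤o M N n≥)) (y≥ n (ℕ.m⊔n≤o⇒n≤o M N n≥)))

rational≤ : ∀ x → ∃[ K ] (0ℚ ℚ.< K × ∃[ N ] (∀ n → N ℕ.≤ n → seq x n ℚ.≤ K))
rational≤ x =
  let (N , close) = cauchy x 1ℚ (ℚ.positive⁻¹ 1ℚ)
  in ℚ.∣ seq x N ∣ ℚ.+ 1ℚ , ℚ.+-mono-≤-< (ℚ.0≤∣p∣ (seq x N)) (ℚ.positive⁻¹ 1ℚ) ,
    N , λ n n≥ → ℚ.≤-trans
      (ℚ-gap⁻¹ (ℚ-gap (∣p-q∣<r⇒p-q≤r {seq x n} {seq x N} (close n N n≥ ℕ.≤-refl)))
        (solve 2 (λ x x′ → con 1ℚ :- (x :- x′) := x′ :+ con 1ℚ :- x) refl (seq x n) (seq x N)))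
      (ℚ.+-monoˡ-≤ 1ℚ (p≤∣p∣ (seq x N)))

≤rational : ∀ x → ∃[ K ] NonNeg (fromℚ K - x)
≤rational x = let (K , _ , N , x≤K) = rational≤ x in
  K , nonNeg λ ε ε>0 → N , λ n n≥ → ℚ-+-nonNeg (ℚ-gap (x≤K n n≥)) (ℚ.<⇒≤ ε>0)

-- With `K` an eventual upper bound of `a` and δ = ε / K, az + ε = a(z + δ) + (K - a)δ. Strict
-- positivity of `a` makes its terms eventually nonnegative, so both summands are.
nonNeg-* : ∀ a {z} → 0ℝ < a → NonNeg z → NonNeg (a * z)
nonNeg-* a {z} (c , c>0 , M , a≥c) z≥0 = nonNeg λ ε ε>0 →
  let (K , K>0 , N , a≤K) = rational≤ a
      instance
        _ = ℚ.positive K>0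
        _ = ℚ.pos⇒nonZero K
      δ = ε ℚ.* (ℚ.1/ K)
      δ>0 = ℚ-*-pos ε>0 (ℚ.positive⁻¹ (ℚ.1/ K) {{ℚ.1/pos⇒pos K}})
      (L , z≥) = approx z≥0 δ δ>0
      Kδ≡ε = trans (cong (K ℚ.*_) (ℚ.*-comm ε (ℚ.1/ K)))
        (trans (sym (ℚ.*-assoc K (ℚ.1/ K) ε))
          (trans (cong (ℚ._* ε) (ℚ.*-inverseʳ K)) (ℚ.*-identityˡ ε)))
  in M ℕ.⊔ N ℕ.⊔ L , λ n n≥ →
    let n≥M⊔N = ℕ.m⊔n≤o⇒m≤o (M ℕ.⊔ N) L n≥
        a≥0 = ℚ.≤-trans (ℚ.≤-trans (ℚ.<⇒≤ c>0) (ℚ.≤-reflexive (sym (ℚ.+-identityˡ c))))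
          (a≥c n (ℕ.m⊔n≤o⇒m≤o M N n≥M⊔N))
    in subst (λ ε → 0ℚ ℚ.≤ seq a n ℚ.* seq z n ℚ.+ ε) Kδ≡ε
      (subst (0ℚ ℚ.≤_)
        (solve 4 (λ a z δ K → a :* (z :+ δ) :+ (K :- a) :* δ := a :* z :+ K :* δ) refl
          (seq a n) (seq z n) δ K)
        (ℚ-+-nonNeg (ℚ-*-nonNeg a≥0 (z≥ n (ℕ.m⊔n≤o⇒n≤o (M ℕ.⊔ N) L n≥)))
          (ℚ-*-nonNeg (ℚ-gap (a≤K n (ℕ.m⊔n≤o⇒n≤o M N n≥M⊔N))) (ℚ.<⇒≤ δ>0))))

fromℚ-pos : ∀ {q} → 0ℚ ℚ.< q → 0ℝ < fromℚ q
fromℚ-pos {q} q>0 = q , q>0 , 0 , λ _ _ → ℚ.≤-reflexive (ℚ.+-identityˡ q)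

fromℚ-nonNeg : ∀ {q} → 0ℚ ℚ.≤ q → NonNeg (fromℚ q)
fromℚ-nonNeg q≥0 = nonNeg λ ε ε>0 → 0 , λ _ _ → ℚ-+-nonNeg q≥0 (ℚ.<⇒≤ ε>0)

nonNeg-widen : ∀ {z p q} → p ℚ.≤ q → NonNeg (z + fromℚ p) → NonNeg (z + fromℚ q)
nonNeg-widen {z} {p} {q} p≤q z≥ = nonNeg-ext (z≥ ⊕ fromℚ-nonNeg (ℚ-gap p≤q))
  (λ n → solve 3 (λ z p q → z :+ p :+ (q :- p) := z :+ q) refl (seq z n) p q)

fromℚ-nonNeg⁻¹ : ∀ {q} → NonNeg (fromℚ q) → 0ℚ ℚ.≤ q
fromℚ-nonNeg⁻¹ {q} q≥0 with 0ℚ ℚ.≤? q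
... | yes 0≤q = 0≤q
... | no  0≰q =
  let q<0 = ℚ.≰⇒> 0≰q
      ε>0 = half-pos (ℚ.neg-antimono-< q<0)
      (N , q≥) = approx q≥0 (½ ℚ.* (ℚ.- q)) ε>0
      ½q≥0 = subst (0ℚ ℚ.≤_)
        (solve 1 (λ q → q :+ con ½ :* (:- q) := con ½ :* q) refl q) (q≥ N ℕ.≤-refl)
  in contradiction (ℚ.*-cancelˡ-≤-pos ½ (subst (ℚ._≤ ½ ℚ.* q) (sym (ℚ.*-zeroʳ ½)) ½q≥0)) 0≰q

nonNeg-scale : ∀ q {z} → 0ℚ ℚ.< q → NonNeg z → NonNeg (fromℚ q * z)
nonNeg-scale q q>0 = nonNeg-* (fromℚ q) (fromℚ-pos q>0)

nonNeg-cancel : ∀ {q z} → 0ℚ ℚ.< q → NonNeg (fromℚ q * z) → NonNeg z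
nonNeg-cancel {q} {z} q>0 qz≥0 = let (r , r>0 , rq≡1) = ℚ-inverse q>0 in
  nonNeg-ext (nonNeg-scale r r>0 qz≥0)
    (λ n → trans (sym (ℚ.*-assoc r q (seq z n)))
      (trans (cong (ℚ._* seq z n) rq≡1) (ℚ.*-identityˡ (seq z n))))

nonNeg-limit : ∀ {z} → (∀ q → 0ℚ ℚ.< q → NonNeg (z + fromℚ q)) → NonNeg z
nonNeg-limit {z} z+q≥0 = nonNeg λ ε ε>0 →
  let (N , z≥) = approx (z+q≥0 (½ ℚ.* ε) (half-pos ε>0)) (½ ℚ.* ε) (half-pos ε>0)
  in N , λ n n≥ → subst (0ℚ ℚ.≤_)
    (solve 2 (λ z ε → z :+ con ½ :* ε :+ con ½ :* ε := z :+ ε) refl (seq z n) ε) (z≥ n n≥)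

-- The sign of a real cannot be decided, but one term beyond the modulus for ε/2 settles it up to ε:
-- that rational is compared with -ε/2.
almostNonNeg⊎negative : ∀ z ε → 0ℚ ℚ.< ε →
  (∃[ N ] (∀ n → N ℕ.≤ n → 0ℚ ℚ.≤ seq z n ℚ.+ ε)) ⊎ z < 0ℝ
almostNonNeg⊎negative z ε ε>0 with cauchy z (½ ℚ.* ε) (half-pos ε>0)
... | N , close with 0ℚ ℚ.≤? seq z N ℚ.+ ½ ℚ.* ε
...   | yes z≥0 = inj₁ (N , λ n n≥ → subst (0ℚ ℚ.≤_)
  (solve 3 (λ z z′ ε → z :+ con ½ :* ε :+ (con ½ :* ε :- (z :- z′)) := z′ :+ ε) refl
    (seq z N) (seq z n) ε)
  (ℚ-+-nonNeg z≥0 (ℚ-gap (∣p-q∣<r⇒p-q≤r {seq z N} {seq z n} (close N n ℕ.≤-refl n≥)))))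
...   | no z≱0 = inj₂
  (ℚ.- (seq z N ℚ.+ ½ ℚ.* ε) , ℚ.neg-antimono-< (ℚ.≰⇒> z≱0) , N , λ n n≥ →
    ℚ-gap⁻¹ (ℚ-gap (∣p-q∣<r⇒p-q≤r {seq z n} {seq z N} (close n N n≥ ℕ.≤-refl)))
      (solve 3 (λ z z′ ε → con ½ :* ε :- (z′ :- z) :=
        con 0ℚ :- (z′ :+ :- (z :+ con ½ :* ε))) refl (seq z N) (seq z n) ε))

-- `x ≤ y` is a mere negation. It refutes the second alternative of the dichotomy for every `ε`, and
-- the first one supplies the index that `NonNeg` asks for.
≤⇒nonNeg : ∀ {x y} → x ≤ y → NonNeg (y - x)
≤⇒nonNeg {x} {y} x≤y = nonNeg λ ε ε>0 →
  fromInj₁ (λ y-x<0 → ⊥-elim (x≤y (flip-sign y-x<0))) (almostNonNeg⊎negative (y - x) ε ε>0)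
  where
  flip-sign : y - x < 0ℝ → y < x
  flip-sign (δ , δ>0 , N , y-x<0) = δ , δ>0 , N , λ n n≥ → ℚ-gap⁻¹ (ℚ-gap (y-x<0 n n≥))
    (solve 3 (λ x y δ → con 0ℚ :- (y :+ :- x :+ δ) := x :- (y :+ δ)) refl
      (seq x n) (seq y n) δ)

<⇒nonNeg : ∀ {x y} ((ε , _) : x < y) → NonNeg (y - x - fromℚ ε)
<⇒nonNeg {x} {y} (ε , ε>0 , N , y≥) = nonNeg λ δ δ>0 → N , λ n n≥ →
  ℚ-+-nonNeg (subst (0ℚ ℚ.≤_)
    (solve 3 (λ x y ε → y :- (x :+ ε) := y :+ :- x :+ :- ε) refl (seq x n) (seq y n) ε)
    (ℚ-gap (y≥ n n≥))) (ℚ.<⇒≤ δ>0)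

-- One half of `q` absorbs the tolerance in `NonNeg`, the other half remains as the gap.
nonNeg⇒< : ∀ {x y q} → 0ℚ ℚ.< q → NonNeg (y - x - fromℚ q) → x < y
nonNeg⇒< {x} {y} {q} q>0 z≥0 =
  let (N , z≥) = approx z≥0 (½ ℚ.* q) (half-pos q>0)
  in ½ ℚ.* q , half-pos q>0 , N , λ n n≥ → ℚ-gap⁻¹ (z≥ n n≥)
    (solve 3 (λ x y q → y :+ :- x :+ :- q :+ con ½ :* q := y :- (x :+ con ½ :* q)) refl
      (seq x n) (seq y n) q)

nonNeg⇒≤ : ∀ {x y} → NonNeg (y - x) → x ≤ y
nonNeg⇒≤ {x} {y} y-x≥0 y<x@(ε , ε>0 , _) = ℚ.<-irrefl refl (ℚ.<-≤-trans ε>0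
  (ℚ-gap⁻¹ (fromℚ-nonNeg⁻¹ {0ℚ ℚ.- ε} (nonNeg-ext (y-x≥0 ⊕ <⇒nonNeg {y} {x} y<x)
    (λ n → solve 3 (λ x y ε → y :+ :- x :+ (x :+ :- y :+ :- ε) := con 0ℚ :- ε) refl
      (seq x n) (seq y n) ε))) refl))

≤-refl : ∀ {x} → x ≤ x
≤-refl {x} = nonNeg⇒≤ {x} {x} (nonNeg-ext
  (fromℚ-nonNeg (ℚ.≤-refl {0ℚ})) (λ n → sym (ℚ.+-inverseʳ (seq x n))))

≤-trans : ∀ {x y z} → x ≤ y → y ≤ z → x ≤ z
≤-trans {x} {y} {z} x≤y y≤z = nonNeg⇒≤ {x} {z} (nonNeg-ext
  (≤⇒nonNeg {x} {y} x≤y ⊕ ≤⇒nonNeg {y} {z} y≤z)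
  (λ n → solve 3 (λ x y z → y :+ :- x :+ (z :+ :- y) := z :+ :- x) refl
    (seq x n) (seq y n) (seq z n)))

≈-sym : ∀ {x y} → x ≈ y → y ≈ x
≈-sym {x} {y} x≈y ε ε>0 = let (N , close) = x≈y ε ε>0 in
  N , λ n n≥ → subst (ℚ._< ε)
    (trans (sym (ℚ.∣-p∣≡∣p∣ (seq x n ℚ.- seq y n)))
      (cong ℚ.∣_∣ (solve 2 (λ x y → :- (x :- y) := y :- x) refl (seq x n) (seq y n))))
    (close n n≥)

≡⇒≈ : ∀ {x y} → (∀ n → seq x n ≡ seq y n) → x ≈ y
≡⇒≈ {x} {y} eq ε ε>0 = 0 , λ n _ → subst (ℚ._< ε)
  (sym (trans (cong (λ q → ℚ.∣ q ℚ.- seq y n ∣) (eq n)) (cong ℚ.∣_∣ (ℚ.+-inverseʳ (seq y n))))) ε>0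

≈⇒nonNeg : ∀ {x y} → x ≈ y → NonNeg (y - x)
≈⇒nonNeg {x} {y} x≈y = nonNeg λ ε ε>0 → let (N , close) = x≈y ε ε>0 in
  N , λ n n≥ → subst (0ℚ ℚ.≤_)
    (solve 3 (λ x y ε → ε :- (x :- y) := y :+ :- x :+ ε) refl (seq x n) (seq y n) ε)
    (ℚ-gap (∣p-q∣<r⇒p-q≤r {seq x n} {seq y n} (close n n≥)))

≈⇒≤ : ∀ {x y} → x ≈ y → x ≤ y
≈⇒≤ {x} {y} x≈y = nonNeg⇒≤ {x} {y} (≈⇒nonNeg {x} {y} x≈y)

≤-antisym : ∀ {x y} → x ≤ y → y ≤ x → x ≈ y
≤-antisym {x} {y} x≤y y≤x ε ε>0 =
  let (M , y≥) = approx (≤⇒nonNeg {x} {y} x≤y) (½ ℚ.* ε) (half-pos ε>0)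
      (N , x≥) = approx (≤⇒nonNeg {y} {x} y≤x) (½ ℚ.* ε) (half-pos ε>0)
  in M ℕ.⊔ N , λ n n≥ → ∣p-q∣<r {seq x n} {seq y n}
    (close (seq x n) (seq y n) (y≥ n (ℕ.m⊔n≤o⇒m≤o M N n≥)))
    (close (seq y n) (seq x n) (x≥ n (ℕ.m⊔n≤o⇒n≤o M N n≥)))
  where
  close : ∀ p q → 0ℚ ℚ.≤ q ℚ.+ (ℚ.- p) ℚ.+ ½ ℚ.* ε → p ℚ.- q ℚ.< ε
  close p q h = ℚ.≤-<-trans
    (ℚ-gap⁻¹ h (solve 3 (λ p q ε → q :+ :- p :+ con ½ :* ε := con ½ :* ε :- (p :- q)) refl p q ε))
    (half<self ε>0)

0<y-x⇒x<y : ∀ {x y} → 0ℝ < y - x → x < y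
0<y-x⇒x<y {x} {y} 0<y-x@(ε , ε>0 , _) = nonNeg⇒< {x} {y} ε>0 (nonNeg-ext
  (<⇒nonNeg {0ℝ} {y - x} 0<y-x)
  (λ n → cong (ℚ._- ε) (ℚ.+-identityʳ (seq (y - x) n))))

<⇒≤ : ∀ {x y} → x < y → x ≤ y
<⇒≤ {x} {y} x<y@(ε , ε>0 , _) = nonNeg⇒≤ {x} {y} (nonNeg-ext
  (<⇒nonNeg {x} {y} x<y ⊕ fromℚ-nonNeg (ℚ.<⇒≤ ε>0))
  (λ n → solve 2 (λ z ε → z :+ :- ε :+ ε := z) refl (seq (y - x) n) ε))

-- With ε the gap from `a` to `b`, x - a - ε is tested against the tolerance ε/2: either `x` exceeds
-- `a` by at least ε/2, or it lies below a + ε and hence below `b`.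
<-cotrans : ∀ {a b} → a < b → ∀ x → x < b ⊎ a < x
<-cotrans {a} {b} (ε , ε>0 , M , b≥) x =
  [ inj₂ ∘ above , inj₁ ∘ below ]′
    (almostNonNeg⊎negative (x - a - fromℚ ε) (½ ℚ.* ε) (half-pos ε>0))
  where
  above : ∃[ N ] (∀ n → N ℕ.≤ n → 0ℚ ℚ.≤ seq (x - a - fromℚ ε) n ℚ.+ ½ ℚ.* ε) → a < x
  above (N , x≥) = ½ ℚ.* ε , half-pos ε>0 , N , λ n n≥ → ℚ-gap⁻¹ (x≥ n n≥)
    (solve 3 (λ a x ε → x :+ :- a :+ :- ε :+ con ½ :* ε := x :- (a :+ con ½ :* ε)) refl
      (seq a n) (seq x n) ε)
  below : x - a - fromℚ ε < 0ℝ → x < b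
  below (δ , δ>0 , N , x≤) = δ , δ>0 , M ℕ.⊔ N , λ n n≥ → ℚ-gap⁻¹
    (ℚ-+-nonNeg (ℚ-gap (b≥ n (ℕ.m⊔n≤o⇒m≤o M N n≥))) (ℚ-gap (x≤ n (ℕ.m⊔n≤o⇒n≤o M N n≥))))
    (solve 5 (λ a b x ε δ → b :- (a :+ ε) :+ (con 0ℚ :- (x :+ :- a :+ :- ε :+ δ)) :=
      b :- (x :+ δ)) refl (seq a n) (seq b n) (seq x n) ε δ)

<-dense : ∀ {a b} → a < b → ∃[ q ] (a ≤ fromℚ q × fromℚ q ≤ b)
<-dense {a} {b} (ε , ε>0 , M , b≥) =
  let (N , close) = cauchy a (½ ℚ.* ε) (half-pos ε>0)
      -- A late term of `a` is within ε/2 of `a`; raised by ε/2 it is at least `a` and at most a +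
      -- ε.
      q = seq a N ℚ.+ ½ ℚ.* ε
  in q
  , nonNeg⇒≤ {a} {fromℚ q} (nonNeg λ δ δ>0 → N , λ n n≥ → ℚ-+-nonNeg (subst (0ℚ ℚ.≤_)
      (solve 3 (λ a a′ ε → con ½ :* ε :- (a′ :- a) := a :+ con ½ :* ε :+ :- a′) refl
        (seq a N) (seq a n) ε)
      (ℚ-gap (∣p-q∣<r⇒p-q≤r {seq a n} {seq a N} (close n N n≥ ℕ.≤-refl)))) (ℚ.<⇒≤ δ>0))
  , nonNeg⇒≤ {fromℚ q} {b} (nonNeg λ δ δ>0 → M ℕ.⊔ N , λ n n≥ → ℚ-+-nonNeg (subst (0ℚ ℚ.≤_)
      (solve 4 (λ a a′ b ε → con ½ :* ε :- (a :- a′) :+ (b :- (a′ :+ ε)) :=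
        b :+ :- (a :+ con ½ :* ε)) refl (seq a N) (seq a n) (seq b n) ε)
      (ℚ-+-nonNeg
        (ℚ-gap (∣p-q∣<r⇒p-q≤r {seq a N} {seq a n} (close N n ℕ.≤-refl (ℕ.m⊔n≤o⇒n≤o M N n≥))))
        (ℚ-gap (b≥ n (ℕ.m⊔n≤o⇒m≤o M N n≥))))) (ℚ.<⇒≤ δ>0))

seq-approx : ∀ x ε → 0ℚ ℚ.< ε → ∃[ N ] (∀ n → N ℕ.≤ n →
  NonNeg (x - fromℚ (seq x n) + fromℚ ε) × NonNeg (fromℚ (seq x n) - x + fromℚ ε))
seq-approx x ε ε>0 = let (N , close) = cauchy x ε ε>0 in N , λ n n≥ →
    (nonNeg λ δ δ>0 → N , λ m m≥ → ℚ-+-nonNeg (subst (0ℚ ℚ.≤_)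
      (solve 3 (λ p q ε → ε :- (p :- q) := q :+ :- p :+ ε) refl (seq x n) (seq x m) ε)
      (ℚ-gap (∣p-q∣<r⇒p-q≤r {seq x n} {seq x m} (close n m n≥ m≥)))) (ℚ.<⇒≤ δ>0))
  , (nonNeg λ δ δ>0 → N , λ m m≥ → ℚ-+-nonNeg (subst (0ℚ ℚ.≤_)
      (solve 3 (λ p q ε → ε :- (q :- p) := p :+ :- q :+ ε) refl (seq x n) (seq x m) ε)
      (ℚ-gap (∣p-q∣<r⇒p-q≤r {seq x m} {seq x n} (close m n m≥ n≥)))) (ℚ.<⇒≤ δ>0))

-- Binary trees of nested intervals

infix 4 _⊑_

_⊑_ : Interval → Interval → Set
I ⊑ J = lo J ≤ lo I × hi I ≤ hi J

⊑-refl : ∀ {I} → I ⊑ I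
⊑-refl {I} = ≤-refl {lo I} , ≤-refl {hi I}

⊑-trans : ∀ {I J K} → I ⊑ J → J ⊑ K → I ⊑ K
⊑-trans {I} {J} {K} (J≤I , I≤J) (K≤J , J≤K) =
  ≤-trans {lo K} {lo J} {lo I} K≤J J≤I , ≤-trans {hi I} {hi J} {hi K} I≤J J≤K

⊑⇒⊆ : ∀ {I J} → I ⊑ J → ∀ {x} → x ∈ ⟦ I ⟧ → x ∈ ⟦ J ⟧
⊑⇒⊆ {I} {J} (J≤I , I≤J) {x} (I≤x , x≤I) =
  ≤-trans {lo J} {lo I} {x} J≤I I≤x , ≤-trans {x} {hi I} {hi J} x≤I I≤J

⊆⇒⊑ : ∀ {I J} → (∀ {x} → x ∈ ⟦ I ⟧ → x ∈ ⟦ J ⟧) → I ⊑ J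
⊆⇒⊑ {I} I⊆J = proj₁ (I⊆J {lo I} (≤-refl {lo I} , lo≤hi I)) , proj₂ (I⊆J {hi I} (lo≤hi I , ≤-refl {hi I}))

⊑-length : ∀ {I J} → I ⊑ J → NonNeg (∣ J ∣ - ∣ I ∣)
⊑-length {I} {J} (J≤I , I≤J) = nonNeg-ext
  (≤⇒nonNeg {lo J} {lo I} J≤I ⊕ ≤⇒nonNeg {hi I} {hi J} I≤J)
  (λ n → solve 4 (λ a b c d → b :+ :- a :+ (d :+ :- c) := d :+ :- a :+ :- (c :+ :- b)) refl
    (seq (lo J) n) (seq (lo I) n) (seq (hi I) n) (seq (hi J) n))

⊑-shorter : ∀ {I J} ε → I ⊑ J → NonNeg (fromℚ ε - ∣ J ∣) → NonNeg (fromℚ ε - ∣ I ∣)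
⊑-shorter {I} {J} ε I⊑J short = nonNeg-ext (short ⊕ ⊑-length {I} {J} I⊑J)
  (λ n → solve 3 (λ ε i j → ε :+ :- j :+ (j :+ :- i) := ε :+ :- i) refl
    ε (seq ∣ I ∣ n) (seq ∣ J ∣ n))

∈-respects : ∀ I {x y} → x ≈ y → x ∈ ⟦ I ⟧ → y ∈ ⟦ I ⟧
∈-respects I {x} {y} x≈y (lo≤x , x≤hi) =
    ≤-trans {lo I} {x} {y} lo≤x (≈⇒≤ {x} {y} x≈y)
  , ≤-trans {y} {x} {hi I} (≈⇒≤ {y} {x} (≈-sym {x} {y} x≈y)) x≤hi

0<⇒nonNeg : ∀ x → 0ℝ < x → NonNeg x
0<⇒nonNeg x x>0 = nonNeg-ext (≤⇒nonNeg {0ℝ} {x} (<⇒≤ {0ℝ} {x} x>0)) (λ n → ℚ.+-identityʳ (seq x n))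

-- Nodes are kept apart from their cells because in the game a node also carries the history on
-- which the strategy depends.
record Tree : Set₁ where
  field
    Node     : Set
    cell     : Node → Interval
    child    : Bool → Node → Node
    nested   : ∀ b p → cell (child b p) ⊑ cell p
    positive : ∀ p → 0ℝ < ∣ cell p ∣

  branch : Node → (ℕ → Bool) → ℕ → Node
  branch p ω zero    = p
  branch p ω (suc n) = child (ω n) (branch p ω n)

  Points : Node → Pred ℝ 0ℓ
  Points p x = ∃[ ω ] (∀ n → x ∈ ⟦ cell (branch p ω n) ⟧)

  -- `branch` applies the latest bit outermost; membership in the points of a child needs the first
  -- bit split off instead.
  branch-shift : ∀ p ω n → branch p ω (suc n) ≡ branch (child (ω 0) p) (ω ∘ suc) n
  branch-shift p ω zero    = refl
  branch-shift p ω (suc n) = cong (child (ω (suc n))) (branch-shift p ω n)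

  branch-nested : ∀ p ω {m n} → m ℕ.≤′ n → cell (branch p ω n) ⊑ cell (branch p ω m)
  branch-nested p ω {m} (ℕ.≤′-reflexive refl) = ⊑-refl {cell (branch p ω m)}
  branch-nested p ω {m} (ℕ.≤′-step {n} m≤n)   =
    ⊑-trans {cell (branch p ω (suc n))} {cell (branch p ω n)} {cell (branch p ω m)}
      (nested (ω n) (branch p ω n)) (branch-nested p ω m≤n)

  Shrinking : Set
  Shrinking = ∀ p ω ε → 0ℚ ℚ.< ε → ∃[ n ] NonNeg (fromℚ ε - ∣ cell (branch p ω n) ∣)

  Splitting : Set
  Splitting = ∀ p → hi (cell (child false p)) < lo (cell (child true p))

-- Limits of shrinking nested intervals

module _ (I : ℕ → Interval)
  (shrinking : ∀ ε → 0ℚ ℚ.< ε → ∃[ n ] NonNeg (fromℚ ε - ∣ I n ∣))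
  (nested : ∀ m n → m ℕ.≤ n → I n ⊑ I m)
  (inside : ∀ n → ∃[ q ] (lo (I n) ≤ fromℚ q × fromℚ q ≤ hi (I n))) where

  private
    q : ℕ → ℚ
    q n = proj₁ (inside n)

    q∈ : ∀ m n → m ℕ.≤ n → fromℚ (q n) ∈ ⟦ I m ⟧
    q∈ m n m≤n = ⊑⇒⊆ {I n} {I m} (nested m n m≤n) {fromℚ (q n)} (proj₂ (inside n))

    q-close : ∀ {K m n ε} → NonNeg (fromℚ (½ ℚ.* ε) - ∣ I K ∣) → 0ℚ ℚ.< ε →
      K ℕ.≤ m → K ℕ.≤ n → q m ℚ.- q n ℚ.< ε
    q-close {K} {m} {n} {ε} short ε>0 K≤m K≤n = ℚ.≤-<-trans
      (ℚ-gap⁻¹ (fromℚ-nonNeg⁻¹ (nonNeg-ext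
          (short ⊕ ≤⇒nonNeg {fromℚ (q m)} {hi (I K)} (proj₂ (q∈ K m K≤m))
            ⊕ ≤⇒nonNeg {lo (I K)} {fromℚ (q n)} (proj₁ (q∈ K n K≤n)))
          (λ k → solve 5 (λ e a b u v →
              e :+ :- (b :+ :- a) :+ (b :+ :- u) :+ (v :+ :- a) := e :- (u :- v)) refl
            (½ ℚ.* ε) (seq (lo (I K)) k) (seq (hi (I K)) k) (q m) (q n))))
        refl)
      (half<self ε>0)

    limit : ℝ
    -- The chosen rationals already form a Cauchy sequence: beyond `K` they all lie in `I K`, whose
    -- length is at most ε/2.
    limit = mkℝ q λ ε ε>0 →
      let (K , short) = shrinking (½ ℚ.* ε) (half-pos ε>0) in
      K , λ m n m≥ n≥ → ∣p-q∣<r {q m} {q n}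
        (q-close {K} {m} {n} short ε>0 m≥ n≥) (q-close {K} {n} {m} short ε>0 n≥ m≥)

  nested-limit : ∃[ x ] (∀ n → x ∈ ⟦ I n ⟧)
  nested-limit = limit , λ n →
      nonNeg⇒≤ {lo (I n)} {limit} (nonNeg-limit λ ε ε>0 →
        let (N , close) = seq-approx limit ε ε>0
            -- `q m` lies in `I n` because m ≥ n, and is within ε of `limit` because m ≥ N.
            m = n ℕ.⊔ N
        in nonNeg-ext
          (≤⇒nonNeg {lo (I n)} {fromℚ (q m)} (proj₁ (q∈ n m (ℕ.m≤m⊔n n N)))
            ⊕ proj₁ (close m (ℕ.m≤n⊔m n N)))
          (λ k → solve 4 (λ a u x ε → u :+ :- a :+ (x :+ :- u :+ ε) := x :+ :- a :+ ε) refl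
            (seq (lo (I n)) k) (q m) (q k) ε))
    , nonNeg⇒≤ {limit} {hi (I n)} (nonNeg-limit λ ε ε>0 →
        let (N , close) = seq-approx limit ε ε>0
            m = n ℕ.⊔ N
        in nonNeg-ext
          (≤⇒nonNeg {fromℚ (q m)} {hi (I n)} (proj₂ (q∈ n m (ℕ.m≤m⊔n n N)))
            ⊕ proj₂ (close m (ℕ.m≤n⊔m n N)))
          (λ k → solve 4 (λ b u x ε → b :+ :- u :+ (u :+ :- x :+ ε) := b :+ :- x :+ ε) refl
            (seq (hi (I n)) k) (q m) (q k) ε))

open Tree

module _ (T : Tree) where

  lo<hi : ∀ p → lo (cell T p) < hi (cell T p)
  lo<hi p = 0<y-x⇒x<y {lo (cell T p)} {hi (cell T p)} (positive T p)

  inside : ∀ p → ∃[ q ] (lo (cell T p) ≤ fromℚ q × fromℚ q ≤ hi (cell T p))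
  inside p = <-dense {lo (cell T p)} {hi (cell T p)} (lo<hi p)

  branch-point : Shrinking T → ∀ p ω → ∃[ x ] (∀ n → x ∈ ⟦ cell T (branch T p ω n) ⟧)
  branch-point shrinking p ω = nested-limit (λ n → cell T (branch T p ω n)) (shrinking p ω)
    (λ m n m≤n → branch-nested T p ω (ℕ.≤⇒≤′ m≤n)) (λ n → inside (branch T p ω n))

  branch-unique : Shrinking T → ∀ p ω {x y} → (∀ n → x ∈ ⟦ cell T (branch T p ω n) ⟧) →
    (∀ n → y ∈ ⟦ cell T (branch T p ω n) ⟧) → x ≈ y
  branch-unique shrinking p ω {x} {y} x∈ y∈ =
    ≤-antisym {x} {y} (below {x} {y} x∈ y∈) (below {y} {x} y∈ x∈)
    where
    below : ∀ {x y} → (∀ n → x ∈ ⟦ cell T (branch T p ω n) ⟧) →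
      (∀ n → y ∈ ⟦ cell T (branch T p ω n) ⟧) → x ≤ y
    below {x} {y} x∈ y∈ = nonNeg⇒≤ {x} {y} (nonNeg-limit λ ε ε>0 →
      let (n , short) = shrinking p ω ε ε>0
          I = cell T (branch T p ω n)
      in nonNeg-ext (short ⊕ ≤⇒nonNeg {x} {hi I} (proj₂ (x∈ n)) ⊕ ≤⇒nonNeg {lo I} {y} (proj₁ (y∈ n)))
        (λ k → solve 5 (λ e a b x y →
            e :+ :- (b :+ :- a) :+ (b :+ :- x) :+ (y :+ :- a) := y :+ :- x :+ e) refl
          ε (seq (lo I) k) (seq (hi I) k) (seq x k) (seq y k)))

  -- Closedness and uncountability of the points of a splitting tree

  module _ (splitting : Splitting T) where

    -- Near p x puts x in the closure of Points T p. A point of Points T p within radius p of x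
    -- tells which child to enter, so the path to x is found without any appeal to compactness.
    Near : Node T → ℝ → Set
    Near p x = ∀ q → 0ℚ ℚ.< q →
      ∃[ y ] (y ∈ Points T p × NonNeg (y - x + fromℚ q) × NonNeg (x - y + fromℚ q))

    near⇒∈ : ∀ {p x} → Near p x → x ∈ ⟦ cell T p ⟧
    near⇒∈ {p} {x} near =
        nonNeg⇒≤ {lo (cell T p)} {x} (nonNeg-limit λ q q>0 →
          let (y , (_ , y∈) , _ , y≤x) = near q q>0 in
          nonNeg-ext (≤⇒nonNeg {lo (cell T p)} {y} (proj₁ (y∈ 0)) ⊕ y≤x)
            (λ k → solve 4 (λ a y x q → y :+ :- a :+ (x :+ :- y :+ q) := x :+ :- a :+ q) refl
              (seq (lo (cell T p)) k) (seq y k) (seq x k) q))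
      , nonNeg⇒≤ {x} {hi (cell T p)} (nonNeg-limit λ q q>0 →
          let (y , (_ , y∈) , x≤y , _) = near q q>0 in
          nonNeg-ext (≤⇒nonNeg {y} {hi (cell T p)} (proj₂ (y∈ 0)) ⊕ x≤y)
            (λ k → solve 4 (λ b y x q → b :+ :- y :+ (y :+ :- x :+ q) := b :+ :- x :+ q) refl
              (seq (hi (cell T p)) k) (seq y k) (seq x k) q))

    -- A quarter of the gap between the two children: two points this close to `x` are at most half
    -- the gap apart.
    radius : Node T → ℚ
    radius p = ½ ℚ.* (½ ℚ.* proj₁ (splitting p))

    radius>0 : ∀ p → 0ℚ ℚ.< radius p
    radius>0 p = half-pos (half-pos (proj₁ (proj₂ (splitting p))))

    -- The gap ε forces z - y ≥ ε, whereas passing through `x` gives z - y ≤ r + ε/4 ≤ ε/2.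
    apart : ∀ p {x y z r} →
      y ∈ ⟦ cell T (child T false p) ⟧ → z ∈ ⟦ cell T (child T true p) ⟧ → r ℚ.≤ radius p →
      NonNeg (y - x + fromℚ r) → NonNeg (x - z + fromℚ (radius p)) → ⊥
    apart p {x} {y} {z} {r} y∈ z∈ r≤ x≤y z≤x = ℚ.<-irrefl refl (ℚ.<-≤-trans (half-pos ε>0)
      (ℚ-gap⁻¹ (fromℚ-nonNeg⁻¹ (nonNeg-ext
        (<⇒nonNeg {hi L} {lo R} (splitting p)
          ⊕ ≤⇒nonNeg {y} {hi L} (proj₂ y∈) ⊕ ≤⇒nonNeg {lo R} {z} (proj₁ z∈)
          ⊕ x≤y ⊕ z≤x ⊕ fromℚ-nonNeg (ℚ-gap r≤))
        (λ k → solve 7 (λ a b x y z r ε →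
            b :+ :- a :+ :- ε :+ (a :+ :- y) :+ (z :+ :- b) :+ (y :+ :- x :+ r) :+
              (x :+ :- z :+ con ½ :* (con ½ :* ε)) :+ (con ½ :* (con ½ :* ε) :- r) :=
            con 0ℚ :- con ½ :* ε) refl
          (seq (hi L) k) (seq (lo R) k) (seq x k) (seq y k) (seq z k) r ε)))
        refl))
      where
      L = cell T (child T false p)
      R = cell T (child T true p)
      ε = proj₁ (splitting p)
      ε>0 = proj₁ (proj₂ (splitting p))

    same-child : ∀ p {x y z r} b c →
      y ∈ ⟦ cell T (child T b p) ⟧ → z ∈ ⟦ cell T (child T c p) ⟧ → r ℚ.≤ radius p →
      NonNeg (y - x + fromℚ r) → NonNeg (x - y + fromℚ r) →
      NonNeg (z - x + fromℚ (radius p)) → NonNeg (x - z + fromℚ (radius p)) → b ≡ c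
    same-child p false false _ _ _ _ _ _ _ = refl
    same-child p true  true  _ _ _ _ _ _ _ = refl
    same-child p {x} {y} {z} {r} false true y∈ z∈ r≤ x≤y _ _ z≤x =
      ⊥-elim (apart p {x} {y} {z} y∈ z∈ r≤ x≤y z≤x)
    same-child p {x} {y} {z} {r} true false y∈ z∈ r≤ _ y≤x x≤z _ =
      -- Now `z` is on the left, so the two points exchange roles and the tolerance `r` of `y` is
      -- widened to `radius p`.
      ⊥-elim (apart p {x} {z} {y} z∈ y∈ ℚ.≤-refl x≤z (nonNeg-ext (y≤x ⊕ fromℚ-nonNeg (ℚ-gap r≤))
        (λ k → solve 4 (λ x y r s → x :+ :- y :+ r :+ (s :- r) := x :+ :- y :+ s) refl
          (seq x k) (seq y k) r (radius p))))

    points-child : ∀ p {x} ((ω , _) : x ∈ Points T p) → x ∈ Points T (child T (ω 0) p)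
    points-child p {x} (ω , x∈) = ω ∘ suc , λ n →
      subst (λ p → x ∈ ⟦ cell T p ⟧) (branch-shift T p ω n) (x∈ (suc n))

    -- The bit has to be fixed before the tolerance `q` is known. One point `z` within `radius p`
    -- fixes it, and by `same-child` every point within the smaller of `q` and `radius p` lies in
    -- the same child.
    near-child : ∀ p x → Near p x → ∃[ b ] Near (child T b p) x
    near-child p x near = first (near (radius p) (radius>0 p))
      where
      WithinOf : Node T → ℚ → Set
      WithinOf p q = ∃[ y ] (y ∈ Points T p × NonNeg (y - x + fromℚ q) × NonNeg (x - y + fromℚ q))

      first : WithinOf p (radius p) → ∃[ b ] Near (child T b p) x
      first (z , (ω , z∈) , x≤z , z≤x) = ω 0 , λ q q>0 →
        second q (positive-⊓ q>0 (radius>0 p))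
        where
        second : ∀ q → ∃[ r ] (0ℚ ℚ.< r × r ℚ.≤ q × r ℚ.≤ radius p) → WithinOf (child T (ω 0) p) q
        second q (r , r>0 , r≤q , r≤) = third (near r r>0)
          where
          third : WithinOf p r → WithinOf (child T (ω 0) p) q
          third (y , y∈@(ω′ , y∈′) , x≤y , y≤x) = y
            , subst (λ b → y ∈ Points T (child T b p))
                (same-child p {x} {y} {z} (ω′ 0) (ω 0) (y∈′ 1) (z∈ 1) r≤ x≤y y≤x x≤z z≤x)
                (points-child p {y} y∈)
            , nonNeg-widen {y - x} r≤q x≤y , nonNeg-widen {x - y} r≤q y≤x

    near⇒points : ∀ p x → Near p x → x ∈ Points T p
    near⇒points p x near = bit , λ n →
      subst (λ p → x ∈ ⟦ cell T p ⟧) (sym (branch≡ n)) (near⇒∈ {proj₁ (state n)} {x} (proj₂ (state n)))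
      where
      state : ℕ → Σ (Node T) λ p → Near p x
      state zero    = p , near
      state (suc n) = let (p , near) = state n ; (b , near′) = near-child p x near in
        child T b p , near′
      bit : ℕ → Bool
      bit n = proj₁ (near-child (proj₁ (state n)) x (proj₂ (state n)))
      branch≡ : ∀ n → branch T p bit n ≡ proj₁ (state n)
      branch≡ zero    = refl
      branch≡ (suc n) = cong (child T (bit n)) (branch≡ n)

    points-closed : ∀ p → IsClosed (Points T p)
    points-closed p x adherent = near⇒points p x λ q q>0 →
      let (y , y∈ , x-q<y , y<x+q) = adherent (fromℚ q) (fromℚ-pos q>0) in
      y , y∈
      , nonNeg-ext (≤⇒nonNeg {x - fromℚ q} {y} (<⇒≤ {x - fromℚ q} {y} x-q<y))
          (λ k → solve 3 (λ x y q → y :+ :- (x :+ :- q) := y :+ :- x :+ q) refl (seq x k) (seq y k) q)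
      , nonNeg-ext (≤⇒nonNeg {y} {x + fromℚ q} (<⇒≤ {y} {x + fromℚ q} y<x+q))
          (λ k → solve 3 (λ x y q → x :+ q :+ :- y := x :+ :- y :+ q) refl (seq x k) (seq y k) q)

    -- Cotransitivity across the gap between the children puts `x` strictly to the left of the right
    -- child or strictly to the right of the left one.
    avoid : ∀ p x → ∃[ b ] ¬ (x ∈ ⟦ cell T (child T b p) ⟧)
    avoid p x = [ (λ x<R → true , λ x∈ → proj₁ x∈ x<R) , (λ L<x → false , λ x∈ → proj₂ x∈ L<x) ]′
      (<-cotrans {hi (cell T (child T false p))} {lo (cell T (child T true p))} (splitting p) x)

    -- Cantor's diagonal argument: the `n`-th bit enters a child that misses `f n`, so the point of
    -- the resulting branch differs from every listed one.
    points-uncountable : Shrinking T → ∀ p → ¬ IsCountable (Points T p)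
    points-uncountable shrinking p (f , listed) = diagonal (branch-point shrinking p bit)
      where
      node : ℕ → Node T
      node zero    = p
      node (suc n) = child T (proj₁ (avoid (node n) (f n))) (node n)
      bit : ℕ → Bool
      bit n = proj₁ (avoid (node n) (f n))
      branch≡ : ∀ n → branch T p bit n ≡ node n
      branch≡ zero    = refl
      branch≡ (suc n) = cong (child T (bit n)) (branch≡ n)
      diagonal : ∃[ x ] (∀ n → x ∈ ⟦ cell T (branch T p bit n) ⟧) → ⊥
      diagonal (x , x∈) = let (n , x≈fn) = listed x (bit , x∈) in
        proj₂ (avoid (node n) (f n)) (∈-respects (cell T (node (suc n))) {x} {f n} x≈fn
          (subst (λ p → x ∈ ⟦ cell T p ⟧) (branch≡ (suc n)) (x∈ (suc n))))

    points-closedUncountable : Shrinking T → ∀ p → IsClosedUncountable (Points T p)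
    points-closedUncountable shrinking p = record
      { respects    = λ {x} {y} x≈y (ω , x∈) → ω , λ n →
          ∈-respects (cell T (branch T p ω n)) {x} {y} x≈y (x∈ n)
      ; closed      = points-closed p
      ; uncountable = points-uncountable shrinking p
      }

-- Trees whose children drift apart

2ℚ : ℚ
2ℚ = + 2 ℚ./ 1

module _ (T : Tree) where

  -- The nodes remain those of `T` and only the steps grow longer, so that branches of the two trees
  -- can be compared directly.
  blocks : ℕ → Tree
  blocks N = record
    { Node     = Node T
    ; cell     = cell T
    ; child    = λ b p → branch T p (const b) N
    ; nested   = λ b p → branch-nested T p (const b) {0} {N} ℕ.z≤′n
    ; positive = positive T
    }

  -- Every bit of ω is repeated throughout one block of N steps.
  module _ (N : ℕ) .{{_ : ℕ.NonZero N}} where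

    stretch : (ℕ → Bool) → ℕ → Bool
    stretch ω n = ω (n / N)

    branch-+ : ∀ p η b m k → (∀ i → i ℕ.< k → η (i ℕ.+ m) ≡ b) →
      branch T (branch T p η m) (const b) k ≡ branch T p η (k ℕ.+ m)
    branch-+ p η b m zero    η≡b = refl
    branch-+ p η b m (suc k) η≡b = cong₂ (child T) (sym (η≡b k ℕ.≤-refl))
      (branch-+ p η b m k (λ i i<k → η≡b i (ℕ.m<n⇒m<1+n i<k)))

    branch-blocks : ∀ p ω n → branch (blocks N) p ω n ≡ branch T p (stretch ω) (n ℕ.* N)
    branch-blocks p ω zero    = refl
    branch-blocks p ω (suc n) = trans (cong (λ p → branch T p (const (ω n)) N) (branch-blocks p ω n))
      (branch-+ p (stretch ω) (ω n) (n ℕ.* N) N λ i i<N → cong ω (begin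
        (i ℕ.+ n ℕ.* N) / N     ≡⟨ +-distrib-/-∣ʳ i (n∣m*n n) ⟩
        i / N ℕ.+ n ℕ.* N / N   ≡⟨ cong₂ ℕ._+_ (m<n⇒m/n≡0 i<N) (m*n/n≡m n N) ⟩
        n                       ∎))
      where open ≡-Reasoning

    -- `n` blocks make n * N steps of `T`, which are at least `n` since `N` is nonzero.
    blocks-⊑ : ∀ p ω n →
      cell (blocks N) (branch (blocks N) p ω n) ⊑ cell T (branch T p (stretch ω) n)
    blocks-⊑ p ω n = subst (λ p′ → cell T p′ ⊑ cell T (branch T p (stretch ω) n))
      (sym (branch-blocks p ω n)) (branch-nested T p (stretch ω) {n} {n ℕ.* N} (ℕ.≤⇒≤′ (ℕ.m≤m*n n N)))

    blocks-shrinking : Shrinking T → Shrinking (blocks N)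
    blocks-shrinking shrinking p ω ε ε>0 =
      let (n , short) = shrinking p (stretch ω) ε ε>0 in
      n , ⊑-shorter {cell (blocks N) (branch (blocks N) p ω n)}
        {cell T (branch T p (stretch ω) n)} ε
        (blocks-⊑ p ω n) short

    blocks-points : ∀ p {x} → x ∈ Points (blocks N) p → x ∈ Points T p
    blocks-points p {x} (ω , x∈) = stretch ω , λ n →
      ⊑⇒⊆ {cell (blocks N) (branch (blocks N) p ω n)} {cell T (branch T p (stretch ω) n)}
        (blocks-⊑ p ω n) {x} (x∈ n)

centre : Interval → ℝ
centre I = lo I + hi I

-- The centres are doubled, so a drift of θ ∣ I ∣ is half as large a displacement.
DriftsLeft DriftsRight : Tree → ℚ → Set
DriftsLeft T θ = ∀ p →
  NonNeg (centre (cell T p) - centre (cell T (child T false p)) - fromℚ θ * ∣ cell T p ∣)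
DriftsRight T θ = ∀ p →
  NonNeg (centre (cell T (child T true p)) - centre (cell T p) - fromℚ θ * ∣ cell T p ∣)

module _ (T : Tree) (θ : ℚ) (θ>0 : 0ℚ ℚ.< θ)
  (left : DriftsLeft T θ) (right : DriftsRight T θ) where

  scaled : ∀ p → NonNeg (fromℚ θ * ∣ cell T p ∣)
  scaled p = nonNeg-scale θ {∣ cell T p ∣} θ>0 (0<⇒nonNeg ∣ cell T p ∣ (positive T p))

  -- Later steps to the left never undo the first one: their own drift is nonnegative and is
  -- discarded, and only the first displacement is kept.
  drift-left : ∀ p n → NonNeg
    (centre (cell T p) - centre (cell T (branch T p (const false) (suc n))) - fromℚ θ * ∣ cell T p ∣)
  drift-left p zero    = nonNeg-ext (left p) (λ _ → refl)
  drift-left p (suc n) = let p′ = branch T p (const false) (suc n) in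
    nonNeg-ext (drift-left p n ⊕ left p′ ⊕ scaled p′)
      (λ k → solve 5 (λ c c′ c″ s s′ →
          c :+ :- c′ :+ :- s :+ (c′ :+ :- c″ :+ :- s′) :+ s′ := c :+ :- c″ :+ :- s) refl
        (seq (centre (cell T p)) k) (seq (centre (cell T p′)) k) (seq (centre (cell T (child T false p′))) k)
        (seq (fromℚ θ * ∣ cell T p ∣) k) (seq (fromℚ θ * ∣ cell T p′ ∣) k))

  drift-right : ∀ p n → NonNeg
    (centre (cell T (branch T p (const true) (suc n))) - centre (cell T p) - fromℚ θ * ∣ cell T p ∣)
  drift-right p zero    = nonNeg-ext (right p) (λ _ → refl)
  drift-right p (suc n) = let p′ = branch T p (const true) (suc n) in
    nonNeg-ext (drift-right p n ⊕ right p′ ⊕ scaled p′)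
      (λ k → solve 5 (λ c c′ c″ s s′ →
          c′ :+ :- c :+ :- s :+ (c″ :+ :- c′ :+ :- s′) :+ s′ := c″ :+ :- c :+ :- s) refl
        (seq (centre (cell T p)) k) (seq (centre (cell T p′)) k) (seq (centre (cell T (child T true p′))) k)
        (seq (fromℚ θ * ∣ cell T p ∣) k) (seq (fromℚ θ * ∣ cell T p′ ∣) k))

  -- A cell containing another whose centre is θ ∣ I ∣ away is longer by at least θ ∣ I ∣.
  decay : ∀ b p → NonNeg (∣ cell T p ∣ - ∣ cell T (child T b p) ∣ - fromℚ θ * ∣ cell T p ∣)
  decay false p = nonNeg-ext (left p ⊕ a≥ ⊕ a≥)
    (λ k → solve 5 (λ a b c d s → a :+ b :+ :- (c :+ d) :+ :- s :+ (c :+ :- a) :+ (c :+ :- a) :=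
        b :+ :- a :+ :- (d :+ :- c) :+ :- s) refl
      (seq (lo (cell T p)) k) (seq (hi (cell T p)) k)
      (seq (lo (cell T (child T false p))) k) (seq (hi (cell T (child T false p))) k)
      (seq (fromℚ θ * ∣ cell T p ∣) k))
    where a≥ = ≤⇒nonNeg {lo (cell T p)} {lo (cell T (child T false p))} (proj₁ (nested T false p))
  decay true p = nonNeg-ext (right p ⊕ b≥ ⊕ b≥)
    (λ k → solve 5 (λ a b c d s → c :+ d :+ :- (a :+ b) :+ :- s :+ (b :+ :- d) :+ (b :+ :- d) :=
        b :+ :- a :+ :- (d :+ :- c) :+ :- s) refl
      (seq (lo (cell T p)) k) (seq (hi (cell T p)) k)
      (seq (lo (cell T (child T true p))) k) (seq (hi (cell T (child T true p))) k)
      (seq (fromℚ θ * ∣ cell T p ∣) k))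
    where b≥ = ≤⇒nonNeg {hi (cell T (child T true p))} {hi (cell T p)} (proj₂ (nested T true p))

  multiple-pos : ∀ n → 0ℚ ℚ.< multiple (suc n) θ
  multiple-pos zero    = ℚ.+-mono-<-≤ θ>0 ℚ.≤-refl
  multiple-pos (suc n) = ℚ.+-mono-< θ>0 (multiple-pos n)

  -- The lengths in fact decay geometrically, but a bound of order 1/n suffices and is linear in θ.
  -- With m = nθ, the step is (1 + m)y = (y - θy) + (θ + m)y ≥ z + (θ + m)z, by `decay` for the
  -- first summand and nesting for the second.
  harmonic-decay : ∀ p ω n → NonNeg
    (∣ cell T p ∣ - fromℚ (1ℚ ℚ.+ multiple n θ) * ∣ cell T (branch T p ω n) ∣)
  harmonic-decay p ω zero    = nonNeg-ext (fromℚ-nonNeg (ℚ.≤-refl {0ℚ}))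
    (λ k → solve 1 (λ x → con 0ℚ := x :+ :- ((con 1ℚ :+ con 0ℚ) :* x)) refl (seq ∣ cell T p ∣ k))
  harmonic-decay p ω (suc n) = nonNeg-ext
    (harmonic-decay p ω n ⊕ decay (ω n) q
      ⊕ nonNeg-scale (multiple (suc n) θ) (multiple-pos n)
          (⊑-length {cell T r} {cell T q} (nested T (ω n) q)))
    (λ k → solve 5 (λ x y z m t →
        x :+ :- ((con 1ℚ :+ m) :* y) :+ (y :+ :- z :+ :- (t :* y)) :+ (t :+ m) :* (y :+ :- z) :=
        x :+ :- ((con 1ℚ :+ (t :+ m)) :* z)) refl
      (seq ∣ cell T p ∣ k) (seq ∣ cell T q ∣ k) (seq ∣ cell T r ∣ k) (multiple n θ) θ)
    where
    q = branch T p ω n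
    r = child T (ω n) q

  drifting-shrinking : Shrinking T
  drifting-shrinking p ω ε ε>0 = bound (≤rational ∣ cell T p ∣) (ℚ-inverse ε>0)
    where
    bound : ∃[ K ] NonNeg (fromℚ K - ∣ cell T p ∣) → ∃[ r ] (0ℚ ℚ.< r × r ℚ.* ε ≡ 1ℚ) →
      ∃[ n ] NonNeg (fromℚ ε - ∣ cell T (branch T p ω n) ∣)
    bound (K , ≤K) (r , _ , rε≡1) =
      let (n , ≤M) = archimedean (K ℚ.* r) θ>0 in suc n , short n ≤M
      where
      short : ∀ n → K ℚ.* r ℚ.≤ multiple n θ → NonNeg (fromℚ ε - ∣ cell T (branch T p ω (suc n)) ∣)
      -- To avoid division the claim is multiplied by 1 + (n + 1)θ. By `harmonic-decay` the length
      -- times this factor is at most `K`, and K = Krε is at most nθε.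
      short n ≤M = nonNeg-cancel (ℚ.+-mono-< (ℚ.positive⁻¹ 1ℚ) (multiple-pos n)) (nonNeg-ext
        (harmonic-decay p ω (suc n) ⊕ ≤K ⊕ fromℚ-nonNeg (ℚ-*-nonNeg (ℚ-gap ≤M) (ℚ.<⇒≤ ε>0))
          ⊕ fromℚ-nonNeg (ℚ-*-nonNeg (ℚ.<⇒≤ (ℚ.+-mono-< (ℚ.positive⁻¹ 1ℚ) θ>0)) (ℚ.<⇒≤ ε>0))
          ⊕ fromℚ-nonNeg (ℚ.≤-reflexive {0ℚ} {K ℚ.* (r ℚ.* ε) ℚ.- K} (sym Krε-K≡0)))
        (λ k → solve 7 (λ x y K r M t ε →
            x :+ :- ((con 1ℚ :+ (t :+ M)) :* y) :+ (K :+ :- x) :+ (M :- K :* r) :* ε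
              :+ (con 1ℚ :+ t) :* ε :+ (K :* (r :* ε) :- K) :=
            (con 1ℚ :+ (t :+ M)) :* (ε :+ :- y)) refl
          (seq ∣ cell T p ∣ k) (seq ∣ cell T (branch T p ω (suc n)) ∣ k) K r (multiple n θ) θ ε))
        where
        Krε-K≡0 : K ℚ.* (r ℚ.* ε) ℚ.- K ≡ 0ℚ
        Krε-K≡0 = trans (cong (λ u → K ℚ.* u ℚ.- K) rε≡1)
          (solve 1 (λ K → K :* con 1ℚ :- K := con 0ℚ) refl K)

  -- After enough equal steps the cells have become short compared with the first
  -- displacement of their centres, which the later steps only increase.
  blocks-splitting : ∃[ n ] Splitting (blocks T (suc n))
  blocks-splitting = bound (ℚ-inverse θ>0)
    where
    bound : ∃[ r ] (0ℚ ℚ.< r × r ℚ.* θ ≡ 1ℚ) → ∃[ n ] Splitting (blocks T (suc n))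
    bound (r , _ , rθ≡1) = let (n , ≤M) = archimedean (2ℚ ℚ.* r) θ>0 in n , split n ≤M
      where
      split : ∀ n → 2ℚ ℚ.* r ℚ.≤ multiple n θ → Splitting (blocks T (suc n))
      split n ≤M p = separated (positive T p)
        where
        I = cell T p
        L = cell T (branch T p (const false) (suc n))
        R = cell T (branch T p (const true) (suc n))
        M = multiple (suc n) θ

        -- The surplus of (θ/2)(1 + M) over 1. It is positive because nθ ≥ 2/θ already gives (θ/2)nθ
        -- ≥ 1; `harmonic-decay` then bounds the final lengths by half of θ ∣ I ∣.
        κ : ℚ
        κ = ½ ℚ.* θ ℚ.* (1ℚ ℚ.+ M) ℚ.- 1ℚ

        κ>0 : 0ℚ ℚ.< κ
        κ>0 = subst (0ℚ ℚ.<_)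
          (trans
            (cong (λ u → (multiple n θ ℚ.- 2ℚ ℚ.* r) ℚ.* (½ ℚ.* θ)
              ℚ.+ (½ ℚ.* θ ℚ.+ ½ ℚ.* θ ℚ.* θ) ℚ.+ (u ℚ.- 1ℚ)) (sym rθ≡1))
            (solve 3 (λ m r t →
              (m :- con 2ℚ :* r) :* (con ½ :* t) :+ (con ½ :* t :+ con ½ :* t :* t)
                :+ (r :* t :- con 1ℚ) :=
              con ½ :* t :* (con 1ℚ :+ (t :+ m)) :- con 1ℚ) refl (multiple n θ) r θ))
          (subst (0ℚ ℚ.<_) (sym (ℚ.+-identityʳ _))
            (ℚ.+-mono-≤-< (ℚ-*-nonNeg (ℚ-gap ≤M) (ℚ.<⇒≤ ½θ>0)) (ℚ.+-mono-< ½θ>0 (ℚ-*-pos ½θ>0 θ>0))))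
          where ½θ>0 = half-pos θ>0

        short : ∀ b → NonNeg (fromℚ (½ ℚ.* θ) * ∣ I ∣ - ∣ cell T (branch T p (const b) (suc n)) ∣)
        short b = nonNeg-ext
          (nonNeg-scale (½ ℚ.* θ) (half-pos θ>0) (harmonic-decay p (const b) (suc n))
            ⊕ nonNeg-scale κ κ>0 (0<⇒nonNeg ∣ J ∣ (positive T (branch T p (const b) (suc n)))))
          (λ k → solve 4 (λ x y h m →
              h :* (x :+ :- ((con 1ℚ :+ m) :* y)) :+ (h :* (con 1ℚ :+ m) :- con 1ℚ) :* y :=
              h :* x :+ :- y) refl
            (seq ∣ I ∣ k) (seq ∣ J ∣ k) (½ ℚ.* θ) M)
          where J = cell T (branch T p (const b) (suc n))

        separated : 0ℝ < ∣ I ∣ → hi L < lo R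
        separated I>0@(g , g>0 , _) = nonNeg⇒< {hi L} {lo R} (ℚ-*-pos (half-pos θ>0) g>0)
          -- Twice lo R - hi L is the difference of the doubled centres minus both lengths. The
          -- former is at least 2θ ∣ I ∣, the lengths together are at most θ ∣ I ∣, and ∣ I ∣ ≥ g.
          (nonNeg-cancel {2ℚ} (ℚ.positive⁻¹ 2ℚ) (nonNeg-ext
            (drift-left p n ⊕ drift-right p n ⊕ short false ⊕ short true
              ⊕ nonNeg-scale θ θ>0 (<⇒nonNeg {0ℝ} {∣ I ∣} I>0))
            (λ k → solve 8 (λ c i a b u v t g →
                c :+ :- (a :+ b) :+ :- (t :* i) :+ (u :+ v :+ :- c :+ :- (t :* i))
                  :+ (con ½ :* t :* i :+ :- (b :+ :- a)) :+ (con ½ :* t :* i :+ :- (v :+ :- u))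
                  :+ t :* (i :+ :- con 0ℚ :+ :- g) :=
                con 2ℚ :* (u :+ :- b :+ :- (con ½ :* t :* g))) refl
              (seq (centre I) k) (seq ∣ I ∣ k) (seq (lo L) k) (seq (hi L) k)
              (seq (lo R) k) (seq (hi R) k) θ g)))

  -- The children in `T` may overlap, so the arguments for splitting trees are applied to the subset
  -- of points whose bits are constant on blocks.
  points-⊇-closedUncountable : ∀ p →
    Σ (Pred ℝ 0ℓ) λ F → IsClosedUncountable F × F ⊆ Points T p
  points-⊇-closedUncountable p = coarsen blocks-splitting
    where
    coarsen : ∃[ n ] Splitting (blocks T (suc n)) →
      Σ (Pred ℝ 0ℓ) λ F → IsClosedUncountable F × F ⊆ Points T p
    coarsen (n , splitting) = Points (blocks T (suc n)) p
      , points-closedUncountable (blocks T (suc n)) splitting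
          (blocks-shrinking T (suc n) drifting-shrinking) p
      , λ {x} → blocks-points T (suc n) p {x}

-- Leaving through the ends

*-positive : ∀ x y → 0ℝ < x → 0ℝ < y → 0ℝ < x * y
*-positive x y x>0@(c , c>0 , _) y>0@(d , d>0 , _) = nonNeg⇒< {0ℝ} {x * y} (ℚ-*-pos d>0 c>0)
  (nonNeg-ext
    (nonNeg-* x x>0 (<⇒nonNeg {0ℝ} {y} y>0) ⊕ nonNeg-scale d d>0 (<⇒nonNeg {0ℝ} {x} x>0))
    (λ n → solve 4 (λ x y c d → x :* (y :+ :- con 0ℚ :+ :- d) :+ d :* (x :+ :- con 0ℚ :+ :- c) :=
        x :* y :+ :- con 0ℚ :+ :- (d :* c)) refl (seq x n) (seq y n) c d))

positive-respects : ∀ {x y} → 0ℝ < x → y ≈ x → 0ℝ < y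
positive-respects {x} {y} x>0@(c , c>0 , _) y≈x = nonNeg⇒< {0ℝ} {y} c>0 (nonNeg-ext
  (<⇒nonNeg {0ℝ} {x} x>0 ⊕ ≈⇒nonNeg {x} {y} (≈-sym {y} {x} y≈x))
  (λ n → solve 3 (λ x y c → x :+ :- con 0ℚ :+ :- c :+ (y :+ :- x) := y :+ :- con 0ℚ :+ :- c) refl
    (seq x n) (seq y n) c))

recip-inverseˡ : ∀ q → 0ℚ ℚ.< q → recip q ℚ.* q ≡ 1ℚ
recip-inverseˡ q q>0 with q ℚ.≟ 0ℚ
... | yes q≡0 = contradiction (sym q≡0) (ℚ.<⇒≢ q>0)
... | no  q≢0 = ℚ.*-inverseˡ q {{ℚ.≢-nonZero q≢0}}

-- The guaranteed displacement of the doubled centre, relative to the length, when an end piece of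
-- ratio `x` is answered by an interval of ratio `y` inside it.
excess : ℝ → ℝ → ℝ
excess x y = 1ℝ - 2ℝ * x + x * y

-- The hypothesis multiplied by `x`. This is done termwise, where x ≥ c makes `recip` a true inverse
-- and turns the margin ε into cε.
excess-positive : ∀ x y (0<x : 0ℝ < x) → 2ℝ - inverse x 0<x < y → 0ℝ < excess x y
excess-positive x y (c , c>0 , M , c≤x) (ε , ε>0 , N , ≤y) =
  c ℚ.* ε , ℚ-*-pos c>0 ε>0 , M ℕ.⊔ N , λ n n≥ →
    let c≤ = ℚ.≤-trans (ℚ.≤-reflexive (sym (ℚ.+-identityˡ c))) (c≤x n (ℕ.m⊔n≤o⇒m≤o M N n≥))
    in pointwise (seq x n) (seq y n) c≤ (≤y n (ℕ.m⊔n≤o⇒n≤o M N n≥))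
  where
  pointwise : ∀ p q → c ℚ.≤ p → 2ℚ ℚ.+ (ℚ.- recip p) ℚ.+ ε ℚ.≤ q →
    0ℚ ℚ.+ c ℚ.* ε ℚ.≤ 1ℚ ℚ.+ (ℚ.- (2ℚ ℚ.* p)) ℚ.+ p ℚ.* q
  pointwise p q c≤p ≤q = ℚ-gap⁻¹
    (ℚ-+-nonNeg (ℚ-*-nonNeg (ℚ.<⇒≤ p>0) (ℚ-gap ≤q)) (ℚ-*-nonNeg (ℚ-gap c≤p) (ℚ.<⇒≤ ε>0)))
    (trans
      (solve 5 (λ p q r c ε → p :* (q :- (con 2ℚ :+ :- r :+ ε)) :+ (p :- c) :* ε :=
        r :* p :+ :- (con 2ℚ :* p) :+ p :* q :- (con 0ℚ :+ c :* ε)) refl p q (recip p) c ε)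
      (cong (λ u → u ℚ.+ (ℚ.- (2ℚ ℚ.* p)) ℚ.+ p ℚ.* q ℚ.- (0ℚ ℚ.+ c ℚ.* ε)) (recip-inverseˡ p p>0)))
    where
    p>0 = ℚ.<-≤-trans c>0 c≤p

module _ (γ : ℝ) (0<γ : 0ℝ < γ) (γ<1 : γ < 1ℝ) where

  portion : ∀ I → 0ℝ < ∣ I ∣ → NonNeg (γ * ∣ I ∣)
  portion I I>0 = nonNeg-* γ {∣ I ∣} 0<γ (0<⇒nonNeg ∣ I ∣ I>0)

  remainder : ∀ I → 0ℝ < ∣ I ∣ → NonNeg ((1ℝ - γ) * ∣ I ∣)
  remainder I I>0 = nonNeg-* (1ℝ - γ) {∣ I ∣} 1-γ>0 (0<⇒nonNeg ∣ I ∣ I>0)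
    where
    1-γ>0 : 0ℝ < 1ℝ - γ
    1-γ>0 = nonNeg⇒< {0ℝ} {1ℝ - γ} (proj₁ (proj₂ γ<1)) (nonNeg-ext (<⇒nonNeg {γ} {1ℝ} γ<1)
      (λ n → solve 2 (λ g e → con 1ℚ :+ :- g :+ :- e := con 1ℚ :+ :- g :+ :- con 0ℚ :+ :- e) refl
        (seq γ n) (proj₁ γ<1)))

  end : Bool → (I : Interval) → 0ℝ < ∣ I ∣ → Interval
  end false I I>0 = record
    { lo = lo I
    ; hi = lo I + γ * ∣ I ∣
    ; lo≤hi = nonNeg⇒≤ {lo I} {lo I + γ * ∣ I ∣} (nonNeg-ext (portion I I>0)
        (λ n → solve 2 (λ a g → g := a :+ g :+ :- a) refl (seq (lo I) n) (seq (γ * ∣ I ∣) n)))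
    }
  end true I I>0 = record
    { lo = hi I - γ * ∣ I ∣
    ; hi = hi I
    ; lo≤hi = nonNeg⇒≤ {hi I - γ * ∣ I ∣} {hi I} (nonNeg-ext (portion I I>0)
        (λ n → solve 2 (λ b g → g := b :+ :- (b :+ :- g)) refl (seq (hi I) n) (seq (γ * ∣ I ∣) n)))
    }

  end-⊑ : ∀ b I I>0 → end b I I>0 ⊑ I
  end-⊑ false I I>0 = ≤-refl {lo I} , nonNeg⇒≤ {lo I + γ * ∣ I ∣} {hi I} (nonNeg-ext (remainder I I>0)
    (λ n → solve 3 (λ g a b → (con 1ℚ :+ :- g) :* (b :+ :- a) := b :+ :- (a :+ g :* (b :+ :- a))) refl
      (seq γ n) (seq (lo I) n) (seq (hi I) n)))
  end-⊑ true I I>0 = nonNeg⇒≤ {lo I} {hi I - γ * ∣ I ∣} (nonNeg-ext (remainder I I>0)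
    (λ n → solve 3 (λ g a b → (con 1ℚ :+ :- g) :* (b :+ :- a) := b :+ :- (g :* (b :+ :- a)) :+ :- a) refl
      (seq γ n) (seq (lo I) n) (seq (hi I) n))) , ≤-refl {hi I}

  end-length : ∀ b I I>0 → ∣ end b I I>0 ∣ ≈ γ * ∣ I ∣
  end-length false I I>0 = ≡⇒≈ {∣ end false I I>0 ∣} {γ * ∣ I ∣}
    (λ n → solve 2 (λ a g → a :+ g :+ :- a := g) refl (seq (lo I) n) (seq (γ * ∣ I ∣) n))
  end-length true I I>0 = ≡⇒≈ {∣ end true I I>0 ∣} {γ * ∣ I ∣}
    (λ n → solve 2 (λ b g → b :+ :- (b :+ :- g) := g) refl (seq (hi I) n) (seq (γ * ∣ I ∣) n))

  module _ (δ : ℝ) (θ : ℚ) (θ<excess : 0ℝ < excess γ δ - fromℚ θ)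
    (I J : Interval) (I>0 : 0ℝ < ∣ I ∣) where

    left-drift : J ⊑ end false I I>0 → ∣ J ∣ ≈ δ * ∣ end false I I>0 ∣ →
      NonNeg (centre I - centre J - fromℚ θ * ∣ I ∣)
    left-drift (_ , J≤) length = nonNeg-ext
      -- The doubled centre of `J` is 2 hi J - ∣ J ∣, so the bound on `hi J` enters twice and the
      -- length once.
      (h ⊕ h
        ⊕ ≈⇒nonNeg {δ * ∣ end false I I>0 ∣} {∣ J ∣}
            (≈-sym {∣ J ∣} {δ * ∣ end false I I>0 ∣} length)
        ⊕ nonNeg-* (excess γ δ - fromℚ θ) θ<excess (0<⇒nonNeg ∣ I ∣ I>0))
      (λ n → solve 7 (λ a b u v g d t →
          (a :+ g :* (b :+ :- a) :+ :- v) :+ (a :+ g :* (b :+ :- a) :+ :- v)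
            :+ (v :+ :- u :+ :- (d :* (a :+ g :* (b :+ :- a) :+ :- a)))
            :+ (con 1ℚ :+ :- (con 2ℚ :* g) :+ g :* d :+ :- t) :* (b :+ :- a) :=
          a :+ b :+ :- (u :+ v) :+ :- (t :* (b :+ :- a))) refl
        (seq (lo I) n) (seq (hi I) n) (seq (lo J) n) (seq (hi J) n) (seq γ n) (seq δ n) θ)
      where h = ≤⇒nonNeg {hi J} {lo I + γ * ∣ I ∣} J≤

    right-drift : J ⊑ end true I I>0 → ∣ J ∣ ≈ δ * ∣ end true I I>0 ∣ →
      NonNeg (centre J - centre I - fromℚ θ * ∣ I ∣)
    right-drift (≤J , _) length = nonNeg-ext
      (h ⊕ h
        ⊕ ≈⇒nonNeg {δ * ∣ end true I I>0 ∣} {∣ J ∣}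
            (≈-sym {∣ J ∣} {δ * ∣ end true I I>0 ∣} length)
        ⊕ nonNeg-* (excess γ δ - fromℚ θ) θ<excess (0<⇒nonNeg ∣ I ∣ I>0))
      (λ n → solve 7 (λ a b u v g d t →
          (u :+ :- (b :+ :- (g :* (b :+ :- a)))) :+ (u :+ :- (b :+ :- (g :* (b :+ :- a))))
            :+ (v :+ :- u :+ :- (d :* (b :+ :- (b :+ :- (g :* (b :+ :- a))))))
            :+ (con 1ℚ :+ :- (con 2ℚ :* g) :+ g :* d :+ :- t) :* (b :+ :- a) :=
          u :+ v :+ :- (a :+ b) :+ :- (t :* (b :+ :- a))) refl
        (seq (lo I) n) (seq (hi I) n) (seq (lo J) n) (seq (hi J) n) (seq γ n) (seq δ n) θ)
      where h = ≤⇒nonNeg {hi I - γ * ∣ I ∣} {lo J} ≤J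

-- Plays against a strategy

unit : Interval
unit = record
  { lo    = 0ℝ
  ; hi    = 1ℝ
  ; lo≤hi = nonNeg⇒≤ {0ℝ} {1ℝ}
      (nonNeg-ext (fromℚ-nonNeg (ℚ.<⇒≤ (ℚ.positive⁻¹ 1ℚ))) (λ _ → refl))
  }

unit-positive : 0ℝ < ∣ unit ∣
unit-positive = 1ℚ , ℚ.positive⁻¹ 1ℚ , 0 , λ _ _ → ℚ.≤-refl

≈ᴵ-refl : ∀ {I} → I ≈ᴵ I
≈ᴵ-refl {I} = ≡⇒≈ {lo I} {lo I} (λ _ → refl) , ≡⇒≈ {hi I} {hi I} (λ _ → refl)

≡⇒≈ᴵ* : ∀ {h h′} → h ≡ h′ → Pointwise _≈ᴵ_ h h′
≡⇒≈ᴵ* {[]}    refl = []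
≡⇒≈ᴵ* {I ∷ h} refl = ≈ᴵ-refl {I} ∷ ≡⇒≈ᴵ* {h} refl

module _ (α β : ℝ) (0<α : 0ℝ < α) (α<1 : α < 1ℝ) (0<β : 0ℝ < β) (β<1 : β < 1ℝ) where

  open Schmidt α β

  ratio : Player → ℝ
  ratio alice = α
  ratio bob   = β

  0<ratio : ∀ P → 0ℝ < ratio P
  0<ratio alice = 0<α
  0<ratio bob   = 0<β

  ratio<1 : ∀ P → ratio P < 1ℝ
  ratio<1 alice = α<1
  ratio<1 bob   = β<1

  respond : ∀ P {h I J} → Situation (opponent P) (I ∷ h) → ⟦ J ⟧ ⊆ ⟦ I ⟧ →
    ∣ J ∣ ≈ ratio (opponent P) * ∣ I ∣ → Situation P (J ∷ I ∷ h)
  respond alice = bobMove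
  respond bob   = aliceMove

  last-⊆ : ∀ P {h I J} → Situation (opponent P) (J ∷ I ∷ h) → ⟦ J ⟧ ⊆ ⟦ I ⟧
  last-⊆ alice (aliceMove _ J⊆I _) {x} = J⊆I {x}
  last-⊆ bob   (bobMove _ J⊆I _) {x} = J⊆I {x}

  last-length : ∀ P {h I J} → Situation (opponent P) (J ∷ I ∷ h) → ∣ J ∣ ≈ ratio P * ∣ I ∣
  last-length alice (aliceMove _ _ eq) = eq
  last-length bob   (bobMove _ _ eq)   = eq

  situation-positive : ∀ {P h I} → Situation P (I ∷ h) → 0ℝ < ∣ I ∣
  situation-positive (opening I>0) = I>0
  situation-positive (aliceMove {h} {A} {B} s _ eq) = positive-respects {α * ∣ B ∣} {∣ A ∣}
    (*-positive α ∣ B ∣ 0<α (situation-positive s)) eq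
  situation-positive (bobMove {h} {A} {B} s _ eq) = positive-respects {β * ∣ A ∣} {∣ B ∣}
    (*-positive β ∣ A ∣ 0<β (situation-positive s)) eq

  module _ (P : Player) (σ : Strategy P) where

    -- The nodes of the tree: moments just after a move of the player `P` who follows `σ`, so that a
    -- child consists of one cut by the opponent and the reply of `σ`.
    record Turn : Set where
      constructor turn
      field
        {interval} : Interval
        {history}  : List Interval
        situation  : Situation (opponent P) (interval ∷ history)

      interval-positive : 0ℝ < ∣ interval ∣
      interval-positive = situation-positive situation

    open Turn

    γ = ratio (opponent P)

    choice : Bool → Turn → Interval
    choice b t =
      end γ (0<ratio (opponent P)) (ratio<1 (opponent P)) b (interval t) (interval-positive t)

    choice-⊑ : ∀ b t → choice b t ⊑ interval t
    choice-⊑ b t =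
      end-⊑ γ (0<ratio (opponent P)) (ratio<1 (opponent P)) b (interval t) (interval-positive t)

    -- The history `h` is left free because in a play it is given by `rounds`, which agrees with the
    -- history of the turn only propositionally.
    choose : ∀ b t {h} → Situation (opponent P) (interval t ∷ h) →
      Situation P (choice b t ∷ interval t ∷ h)
    choose b t s = respond P s (λ {x} → ⊑⇒⊆ {choice b t} {interval t} (choice-⊑ b t) {x})
      (end-length γ (0<ratio (opponent P)) (ratio<1 (opponent P)) b
        (interval t) (interval-positive t))

    next : Bool → Turn → Turn
    next b t = turn (legal σ (choose b t (situation t)))

    reply-⊑ : ∀ b t → interval (next b t) ⊑ choice b t
    reply-⊑ b t = ⊆⇒⊑ {interval (next b t)} {choice b t} (λ {x} → last-⊆ P (situation (next b t)) {x})

    tree : Tree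
    tree = record
      { Node     = Turn
      ; cell     = interval
      ; child    = next
      ; nested   = λ b t → ⊑-trans {interval (next b t)} {choice b t} {interval t}
          (reply-⊑ b t) (choice-⊑ b t)
      ; positive = interval-positive
      }

    tree-left : ∀ θ → 0ℝ < excess γ (ratio P) - fromℚ θ → DriftsLeft tree θ
    tree-left θ θ< t = nonNeg-ext
      (left-drift γ (0<ratio (opponent P)) (ratio<1 (opponent P)) (ratio P) θ θ<
        (interval t) (interval (next false t)) (interval-positive t)
        (reply-⊑ false t) (last-length P (situation (next false t))))
      (λ _ → refl)

    tree-right : ∀ θ → 0ℝ < excess γ (ratio P) - fromℚ θ → DriftsRight tree θ
    tree-right θ θ< t = nonNeg-ext
      (right-drift γ (0<ratio (opponent P)) (ratio<1 (opponent P)) (ratio P) θ θ<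
        (interval t) (interval (next true t)) (interval-positive t)
        (reply-⊑ true t) (last-length P (situation (next true t))))
      (λ _ → refl)

    module _ (excess>0 : 0ℝ < excess γ (ratio P)) where

      private
        θ : ℚ
        -- Half of the margin of `excess>0`, so that `excess` minus `θ` is still strictly positive.
        θ = ½ ℚ.* proj₁ excess>0

        θ>0 : 0ℚ ℚ.< θ
        θ>0 = half-pos (proj₁ (proj₂ excess>0))

        θ<excess : 0ℝ < excess γ (ratio P) - fromℚ θ
        θ<excess = nonNeg⇒< {0ℝ} {excess γ (ratio P) - fromℚ θ} θ>0
          (nonNeg-ext (<⇒nonNeg {0ℝ} {excess γ (ratio P)} excess>0)
            (λ n → solve 2 (λ x e → x :+ :- con 0ℚ :+ :- e :=
                x :+ :- (con ½ :* e) :+ :- con 0ℚ :+ :- (con ½ :* e)) refl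
              (seq (excess γ (ratio P)) n) (proj₁ excess>0)))

      tree-shrinking : Shrinking tree
      tree-shrinking = drifting-shrinking tree θ θ>0 (tree-left θ θ<excess) (tree-right θ θ<excess)

      tree-points : ∀ t → Σ (Pred ℝ 0ℓ) λ F → IsClosedUncountable F × F ⊆ Points tree t
      tree-points = points-⊇-closedUncountable tree θ θ>0 (tree-left θ θ<excess) (tree-right θ θ<excess)

  module _ (τ : Strategy bob) (η : ℕ → Bool) where

    bob-root : Turn bob τ
    bob-root = turn (legal τ start)

    module BobPlay where

      position : ℕ → Turn bob τ
      position = branch (tree bob τ) bob-root η

      B′ A′ : ℕ → Interval
      B′ n = Turn.interval (position n)
      A′ n = choice bob τ (η n) (position n)

      history≡ : ∀ n → Turn.history (position n) ≡ rounds B′ A′ n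
      history≡ zero    = refl
      history≡ (suc n) = cong (λ h → A′ n ∷ B′ n ∷ h) (history≡ n)

      alice-turn : ∀ n → Situation alice (B′ n ∷ rounds B′ A′ n)
      alice-turn n = subst (λ h → Situation alice (B′ n ∷ h)) (history≡ n) (Turn.situation (position n))

      bob-turn : ∀ n → Situation bob (rounds B′ A′ n)
      bob-turn zero    = start
      bob-turn (suc n) = choose bob τ (η n) (position n) (alice-turn n)

    bob-play : Play
    bob-play = record { B = BobPlay.B′ ; A = BobPlay.A′
      ; bobToMove = BobPlay.bob-turn ; aliceToMove = BobPlay.alice-turn }

    bob-play-follows : Follows bob τ bob-play
    bob-play-follows zero    = ≈ᴵ-refl {move τ start}
    -- The interval was produced by `τ` in the situation of the tree, while the play presents a
    -- transported one; the histories agree, so `move-cong` identifies the two moves.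
    bob-play-follows (suc n) = move-cong τ _ _ (≡⇒≈ᴵ* (history≡ (suc n)))
      where open BobPlay

  module _ (σ : Strategy alice) (η : ℕ → Bool) where

    alice-root : Turn alice σ
    alice-root = turn (legal σ (opening {unit} unit-positive))

    module AlicePlay where

      position : ℕ → Turn alice σ
      position = branch (tree alice σ) alice-root η

      A′ B′ : ℕ → Interval
      A′ n       = Turn.interval (position n)
      -- Bob's opening is free. The nodes are Alice's intervals, so the bit `η n` governs the
      -- interval Bob chooses one round later.
      B′ zero    = unit
      B′ (suc n) = choice alice σ (η n) (position n)

      history≡ : ∀ n → Turn.history (position n) ≡ B′ n ∷ rounds B′ A′ n
      history≡ zero    = refl
      history≡ (suc n) = cong (λ h → B′ (suc n) ∷ A′ n ∷ h) (history≡ n)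

      bob-turn : ∀ n → Situation bob (rounds B′ A′ n)
      bob-turn zero    = start
      bob-turn (suc n) = subst (λ h → Situation bob (A′ n ∷ h)) (history≡ n) (Turn.situation (position n))

      alice-turn : ∀ n → Situation alice (B′ n ∷ rounds B′ A′ n)
      alice-turn zero    = opening unit-positive
      alice-turn (suc n) = choose alice σ (η n) (position n) (bob-turn (suc n))

    alice-play : Play
    alice-play = record { B = AlicePlay.B′ ; A = AlicePlay.A′
      ; bobToMove = AlicePlay.bob-turn ; aliceToMove = AlicePlay.alice-turn }

    alice-play-follows : Follows alice σ alice-play
    alice-play-follows zero    = ≈ᴵ-refl {move σ (opening {unit} unit-positive)}
    alice-play-follows (suc n) = move-cong σ _ _ (≡⇒≈ᴵ* (history≡ (suc n)))
      where open AlicePlay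

  -- Bernstein sets defeat every strategy

  module _ (S : Pred ℝ 0ℓ) (bernstein : IsBernstein S) where

    -- A point of `S` in the Cantor set lies in all of Bob's intervals along some branch, and Alice
    -- wins the corresponding play although Bob follows `τ`.
    bob-loses : 0ℝ < excess α β → ¬ HasWinningStrategy bob S
    bob-loses excess>0 (τ , wins) = defeat (tree-points bob τ excess>0 (turn (legal τ start)))
      where
      defeat : (Σ (Pred ℝ 0ℓ) λ F → IsClosedUncountable F ×
        F ⊆ Points (tree bob τ) (turn (legal τ start))) → ⊥
      defeat (F , F-closedUncountable , F⊆) =
        let (x , x∈S , x∈F) = IsBernstein.meets bernstein F F-closedUncountable
            (η , x∈B) = F⊆ {x} x∈F
        in wins (bob-play τ η) (bob-play-follows τ η) (x , x∈B , x∈S)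

    alice-loses : 0ℝ < excess β α → ¬ HasWinningStrategy alice S
    alice-loses excess>0 (σ , wins) = defeat (tree-points alice σ excess>0 root)
      where
      root : Turn alice σ
      root = turn (legal σ (opening {unit} unit-positive))

      -- Alice's win only provides some `y` in `S` common to Bob's intervals. It lies in Alice's
      -- intervals too, as each contains Bob's next one, and since these shrink to a point, `y`
      -- equals `x`.
      target : ∀ {x} η → (∀ n → x ∈ ⟦ Turn.interval (branch (tree alice σ) root η n) ⟧) →
        Wins alice S (alice-play σ η) → x ∈ S
      target {x} η x∈A (y , y∈B , y∈S) = IsBernstein.respects bernstein {y} {x}
        (branch-unique (tree alice σ) (tree-shrinking alice σ excess>0) root η {y} {x}
          (λ n → ⊑⇒⊆ {choice alice σ (η n) (AlicePlay.position σ η n)} {AlicePlay.A′ σ η n}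
            (choice-⊑ alice σ (η n) (AlicePlay.position σ η n)) {y} (y∈B (suc n)))
          x∈A)
        y∈S

      defeat : (Σ (Pred ℝ 0ℓ) λ F → IsClosedUncountable F ×
        F ⊆ Points (tree alice σ) root) → ⊥
      defeat (F , F-closedUncountable , F⊆) =
        IsBernstein.omits bernstein F F-closedUncountable λ {x} x∈F →
          let (η , x∈A) = F⊆ {x} x∈F
          in target {x} η x∈A (wins (alice-play σ η) (alice-play-follows σ η))

theorem3 : (α β : ℝ) (0<α : 0ℝ < α) (α<1 : α < 1ℝ) (0<β : 0ℝ < β) (β<1 : β < 1ℝ) →
    β > 2ℝ - inverse α 0<α →
    α > 2ℝ - inverse β 0<β →
    (S : Pred ℝ 0ℓ) → IsBernstein S →
    ¬ Schmidt.Determined α β S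
theorem3 α β 0<α α<1 0<β β<1 β> α> S bernstein =
  -- Against Alice the cuts have ratio β and the replies ratio α, so the bound on α is the one that
  -- applies; against Bob the roles are reversed.
  [ alice-loses α β 0<α α<1 0<β β<1 S bernstein (excess-positive β α 0<β α>)
  , bob-loses α β 0<α α<1 0<β β<1 S bernstein (excess-positive α β 0<α β>)
  ]′
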